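{- For all positive integers $n$ and non-negative integers $k$, $$\det_{0\le i,j\le n-1}\Big(\frac{2k+2}{i+j+k+1}\binom{2i+2j-1}{i+j+k}\Big)= \begin{cases} (-1)^{n_1\binom{k+1}2+1}(n_1-1), & n=(k+1)n_1,\\ (-1)^{n_1\binom{k+1}2+k+1}n_1, & n=(k+1)n_1+1,\\ 0, & n\not\equiv0,1\pmod{k+1}, \end{cases}$$ where the $(0,0)$-entry of the matrix is defined to be $0$, and $n_1$ is a non-negative integer (for $k=0$, the first case is meant).
   Context: Binomial coefficients $\binom ab$ with $a\ge0$ are $0$ if $b<0$ or $b>a$. -}

module Defs where

open import Algebra.Bundles using (CommutativeRing)
open import Data.Fin.Base using (Fin; zero; suc; toℕ; punchIn)
open import Data.Integer.Base using (+_)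
open import Data.Nat.Base using (ℕ; zero; suc; _+_; _*_; _∸_)
open import Data.Nat.Combinatorics using (_C_)
open import Data.Rational.Base as ℚ using (ℚ; 0ℚ; _/_)
open import Data.Rational.Properties using (+-*-commutativeRing)

module Determinant {c ℓ} (R : CommutativeRing c ℓ) where
  open CommutativeRing R using (Carrier; 1#; -_; semiring) renaming (_*_ to _·_)
  open import Algebra.Properties.Semiring.Exp semiring using (_^_)
  open import Algebra.Properties.Semiring.Sum semiring using (sum)

  Matrix : ℕ → Set c
  Matrix n = Fin n → Fin n → Carrier

  minor₀ : ∀ {n} → Matrix (suc n) → Fin (suc n) → Matrix n
  minor₀ M j i′ j′ = M (suc i′) (punchIn j j′)

  -- Laplace expansion along the first row; the empty determinant is 1.
  det : ∀ {n} → Matrix n → Carrier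
  det {zero}  M = 1#
  det {suc n} M = sum (λ j → (- 1#) ^ toℕ j · (M zero j · det (minor₀ M j)))

open Determinant +-*-commutativeRing public using (det)

-- Away from (0,0) we have 2i+2j ≥ 2, so the truncated subtraction is exact.
-- The library's  a C b  is 0 for b > a.
entry : ℕ → ℕ → ℕ → ℚ
entry k zero zero = 0ℚ
entry k i    j    =
  (+ (2 * k + 2) / suc (i + j + k)) ℚ.* (+ ((2 * i + 2 * j ∸ 1) C (i + j + k)) / 1)

matrix : ∀ (k n : ℕ) → Fin n → Fin n → ℚ
matrix k n i j = entry k (toℕ i) (toℕ j)

{-# OPTIONS --safe #-}
module Submission where

-- Away from (0,0) the entry is the number of non-negative lattice paths from height 0 to
-- height 2k+1 with 2(i+j)-1 steps, so the matrix is the Hankel matrix of the sequence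
-- m ↦ (J^m x) 0, where J is the tridiagonal operator of the Catalan moments and
-- x = (0,…,0,1,-1,1,…) starts with K = k+1 zeros; this x also produces the entry 0 at
-- m = 0.  Unitriangular row and column operations replace the rows J^i x by x, S 0, S 1, …,
-- where S r = e (K+r) + e (K-1-r) and e (-1-j) stands for - e j.
--
-- As a function of its first row x the determinant kills the vectors S r.  Hence its
-- coefficients are odd under the reflections of the column index about the multiples of
-- K, all complete blocks of K columns contribute equally, and the number of blocks is the
-- factor n₁ - 1 or n₁.  The last block reduces to the determinant of S 0, S 1, …, which is
-- unchanged when 2K rows and columns are removed.

open import Defs
open import Algebra.Bundles using (CommutativeRing)
open import Data.Fin.Base using (Fin; zero; suc; toℕ; punchIn)
open import Data.Integer.Base as ℤ using (ℤ; +_; -1ℤ; 0ℤ; 1ℤ)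
import Data.Integer.Properties as ℤ
open import Data.Integer.Tactic.RingSolver using (solve-∀)
open import Data.Nat.Base using (ℕ; zero; suc; _+_; _*_; _∸_; _≥_; _≤_; _<_; z≤n; s≤s; z<s; s<s) renaming (_/_ to _/ℕ_)
open import Data.Nat.Combinatorics using (_C_; nCk+nC[k+1]≡[n+1]C[k+1]; nCk≡nC[n∸k]; nC1≡n; k>n⇒nCk≡0)
open import Data.Nat.DivMod using (_%_; m≡m%n+[m/n]*n; m%n<n)
open import Data.Nat.GeneralisedArithmetic using (fold; iterate; iterate-is-fold)
import Data.Nat.Properties as ℕ
open import Data.Nat.Tactic.RingSolver renaming (solve-∀ to solveℕ-∀)
open import Data.Product.Base using (_×_; _,_)
open import Data.Rational.Base as ℚ using (ℚ; 0ℚ; _/_)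
import Data.Rational.Properties as ℚ
import Data.Rational.Unnormalised.Base as ℚᵘ
import Data.Rational.Unnormalised.Properties as ℚᵘ
open import Function.Base using (_∘_)
open import Relation.Binary.PropositionalEquality using (_≡_; _≢_; refl; sym; trans; cong; cong₂; subst; module ≡-Reasoning)
open import Relation.Nullary.Negation using (contradiction)
open import Algebra.Properties.Semiring.Exp (CommutativeRing.semiring ℚ.+-*-commutativeRing) using () renaming (_^_ to _^ℚ_)
open import Algebra.Properties.Semiring.Sum (CommutativeRing.semiring ℚ.+-*-commutativeRing) using (sum)
open ≡-Reasoning

-- Rows are infinite vectors and a determinant reads only a corner of them, so `J`, `S` and
-- `alternating` act without truncation at the right edge. Membership in a span is stated dually, as
-- a property of every linear functional that kills the spanning vectors. The coefficients of the
-- unitriangular operations are never computed; the functional in use is the determinant as a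
-- function of one row.
--
-- Why the blocks agree: killing `S r` means that `e (K+r)` and `e (K-1-r)` get opposite values.
-- Together with `e (-1-j) = - e j`, the reflections about 0 and K generate those about all
-- multiples of K. An index and its mirror image have opposite parity, so the alternating signs of x
-- change too and each product of sign and value is preserved. However, as a function of its first
-- row a determinant of size n kills only `S r` with r < n-1, so the reflections are available only
-- up to that bound. The last block is special because its mirror columns lie outside the matrix.

sgn : ℕ → ℤ
sgn zero    = 1ℤ
sgn (suc n) = ℤ.- sgn n

sgn-+ : ∀ m n → sgn (m + n) ≡ sgn m ℤ.* sgn n
sgn-+ zero    n = sym (ℤ.*-identityˡ (sgn n))
sgn-+ (suc m) n = trans (cong ℤ.-_ (sgn-+ m n)) (ℤ.neg-distribˡ-* (sgn m) (sgn n))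

sgn-square : ∀ n → sgn n ℤ.* sgn n ≡ 1ℤ
sgn-square zero    = refl
sgn-square (suc n) = trans (neg*neg (sgn n)) (sgn-square n)
  where
  neg*neg : ∀ x → (ℤ.- x) ℤ.* (ℤ.- x) ≡ x ℤ.* x
  neg*neg = solve-∀

opaque
  ∑ : ℕ → (ℕ → ℤ) → ℤ
  ∑ zero    f = 0ℤ
  ∑ (suc n) f = f 0 ℤ.+ ∑ n (f ∘ suc)

  ∑-suc : ∀ n (f : ℕ → ℤ) → ∑ (suc n) f ≡ f 0 ℤ.+ ∑ n (f ∘ suc)
  ∑-suc n f = refl

  ∑-cong : ∀ n {f g : ℕ → ℤ} → (∀ j → j < n → f j ≡ g j) → ∑ n f ≡ ∑ n g
  ∑-cong zero    eq = refl
  ∑-cong (suc n) eq = cong₂ ℤ._+_ (eq 0 z<s) (∑-cong n (λ j j<n → eq (suc j) (s<s j<n)))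

  ∑-zero : ∀ n {f : ℕ → ℤ} → (∀ j → j < n → f j ≡ 0ℤ) → ∑ n f ≡ 0ℤ
  ∑-zero zero    eq = refl
  ∑-zero (suc n) eq = cong₂ ℤ._+_ (eq 0 z<s) (∑-zero n (λ j j<n → eq (suc j) (s<s j<n)))

  ∑-linear : ∀ n a (f g : ℕ → ℤ) → ∑ n (λ j → a ℤ.* f j ℤ.+ g j) ≡ a ℤ.* ∑ n f ℤ.+ ∑ n g
  ∑-linear zero    a f g = sym (trans (ℤ.+-identityʳ _) (ℤ.*-zeroʳ a))
  ∑-linear (suc n) a f g =
    trans (cong (λ z → (a ℤ.* f 0 ℤ.+ g 0) ℤ.+ z) (∑-linear n a (f ∘ suc) (g ∘ suc))) (rearrange a (f 0) (g 0) _ _)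
    where
    rearrange : ∀ a x y s t → a ℤ.* x ℤ.+ y ℤ.+ (a ℤ.* s ℤ.+ t) ≡ a ℤ.* (x ℤ.+ s) ℤ.+ (y ℤ.+ t)
    rearrange = solve-∀

  ∑-distribˡ : ∀ n a (f : ℕ → ℤ) → a ℤ.* ∑ n f ≡ ∑ n (λ j → a ℤ.* f j)
  ∑-distribˡ zero    a f = ℤ.*-zeroʳ a
  ∑-distribˡ (suc n) a f = trans (ℤ.*-distribˡ-+ a (f 0) _) (cong (λ z → (a ℤ.* f 0) ℤ.+ z) (∑-distribˡ n a (f ∘ suc)))

  ∑-neg : ∀ n (f : ℕ → ℤ) → ∑ n (λ j → ℤ.- f j) ≡ ℤ.- ∑ n f
  ∑-neg zero    f = refl
  ∑-neg (suc n) f = trans (cong (λ z → (ℤ.- f 0) ℤ.+ z) (∑-neg n (f ∘ suc))) (sym (ℤ.neg-distrib-+ (f 0) _))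

  ∑-+ : ∀ n (f g : ℕ → ℤ) → ∑ n (λ j → f j ℤ.+ g j) ≡ ∑ n f ℤ.+ ∑ n g
  ∑-+ zero    f g = refl
  ∑-+ (suc n) f g = trans (cong (λ z → (f 0 ℤ.+ g 0) ℤ.+ z) (∑-+ n (f ∘ suc) (g ∘ suc))) (rearrange (f 0) (g 0) _ _)
    where
    rearrange : ∀ x y s t → x ℤ.+ y ℤ.+ (s ℤ.+ t) ≡ x ℤ.+ s ℤ.+ (y ℤ.+ t)
    rearrange = solve-∀

  ∑-swap : ∀ m n (f : ℕ → ℕ → ℤ) → ∑ m (λ i → ∑ n (f i)) ≡ ∑ n (λ j → ∑ m (λ i → f i j))
  ∑-swap zero    n f = sym (∑-zero n (λ _ _ → refl))
  ∑-swap (suc m) n f =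
    trans (cong (λ z → ∑ n (f 0) ℤ.+ z) (∑-swap m n (f ∘ suc))) (sym (∑-+ n (f 0) (λ j → ∑ m (λ i → f (suc i) j))))

  ∑-split : ∀ m n (f : ℕ → ℤ) → ∑ (m + n) f ≡ ∑ m f ℤ.+ ∑ n (λ j → f (m + j))
  ∑-split zero    n f = sym (ℤ.+-identityˡ _)
  ∑-split (suc m) n f = trans (cong (λ z → f 0 ℤ.+ z) (∑-split m n (f ∘ suc))) (sym (ℤ.+-assoc (f 0) _ _))

  ∑-last : ∀ n (f : ℕ → ℤ) → ∑ (suc n) f ≡ ∑ n f ℤ.+ f n
  ∑-last zero    f = ℤ.+-comm (f 0) 0ℤ
  ∑-last (suc n) f = trans (cong (λ z → f 0 ℤ.+ z) (∑-last n (f ∘ suc))) (sym (ℤ.+-assoc (f 0) _ _))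

  ∑-reverse : ∀ n (f g : ℕ → ℤ) → (∀ t t′ → suc (t + t′) ≡ n → f t ≡ g t′) → ∑ n f ≡ ∑ n g
  ∑-reverse zero    f g eq = refl
  ∑-reverse (suc n) f g eq = begin
    f 0 ℤ.+ ∑ n (f ∘ suc) ≡⟨ cong₂ ℤ._+_ (eq 0 n refl) (∑-reverse n (f ∘ suc) g λ t t′ p → eq (suc t) t′ (cong suc p)) ⟩
    g n ℤ.+ ∑ n g         ≡⟨ ℤ.+-comm (g n) _ ⟩
    ∑ n g ℤ.+ g n         ≡⟨ ∑-last n g ⟨
    ∑ (suc n) g           ∎

-- Laplace expansions for corners of infinite matrices

Vector : Set
Vector = ℕ → ℤ

Rows : Set
Rows = ℕ → Vector

e : ℕ → Vector
e zero    zero    = 1ℤ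
e zero    (suc j) = 0ℤ
e (suc p) zero    = 0ℤ
e (suc p) (suc j) = e p j

e-diagonal : ∀ p → e p p ≡ 1ℤ
e-diagonal zero    = refl
e-diagonal (suc p) = e-diagonal p

e-off : ∀ p j → p ≢ j → e p j ≡ 0ℤ
e-off zero    zero    p≢j with () ← p≢j refl
e-off zero    (suc j) p≢j = refl
e-off (suc p) zero    p≢j = refl
e-off (suc p) (suc j) p≢j = e-off p j (p≢j ∘ cong suc)

opaque
  unfolding ∑

  ∑-pick : ∀ n p (f : ℕ → ℤ) → p < n → ∑ n (λ j → f j ℤ.* e p j) ≡ f p
  ∑-pick (suc n) zero f _ = trans
    (cong₂ ℤ._+_ (ℤ.*-identityʳ (f 0)) (∑-zero n (λ j _ → ℤ.*-zeroʳ (f (suc j)))))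
    (ℤ.+-identityʳ (f 0))
  ∑-pick (suc n) (suc p) f (s≤s p<n) = trans
    (cong₂ ℤ._+_ (ℤ.*-zeroʳ (f 0)) (∑-pick n p (f ∘ suc) p<n))
    (ℤ.+-identityˡ _)

-- This is `punchIn` on natural numbers.
skip : ℕ → ℕ → ℕ
skip zero    x       = suc x
skip (suc j) zero    = zero
skip (suc j) (suc x) = suc (skip j x)

skip-< : ∀ {n} j x → x < n → skip j x < suc n
skip-< zero    x       x<n       = s<s x<n
skip-< (suc j) zero    x<n       = z<s
skip-< (suc j) (suc x) (s≤s x<n) = s<s (skip-< j x x<n)

skip-below : ∀ j x → x < j → skip j x ≡ x
skip-below (suc j) zero    _         = refl
skip-below (suc j) (suc x) (s≤s x<j) = cong suc (skip-below j x x<j)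

opaque
  -- The same expansion as `det`, but with natural numbers as indices, so that rows can be inserted,
  -- skipped and shifted without bounds in the types. Being opaque, it is expanded only through
  -- `Det-suc`.
  Det : ℕ → Rows → ℤ
  Det zero    M = 1ℤ
  Det (suc n) M = ∑ (suc n) (λ j → sgn j ℤ.* (M 0 j ℤ.* Det n (λ i l → M (suc i) (skip j l))))

  Det-zero : ∀ M → Det 0 M ≡ 1ℤ
  Det-zero M = refl

  Det-suc : ∀ n M → Det (suc n) M ≡ ∑ (suc n) (λ j → sgn j ℤ.* (M 0 j ℤ.* Det n (λ i l → M (suc i) (skip j l))))
  Det-suc n M = refl

  Det-cong : ∀ n {M N : Rows} → (∀ i j → i < n → j < n → M i j ≡ N i j) → Det n M ≡ Det n N
  Det-cong zero    eq = refl
  Det-cong (suc n) eq = ∑-cong (suc n) λ j j<n → cong (sgn j ℤ.*_)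
    (cong₂ ℤ._*_ (eq 0 j z<s j<n)
      (Det-cong n (λ i l i<n l<n → eq (suc i) (skip j l) (s<s i<n) (skip-< j l l<n))))

-- The corner entry is split off, and the other minors of row 0 are expanded along their first
-- column by induction. The resulting double sum is symmetric in row 0 and column 0, so exchanging
-- the summations turns it into the column minors expanded along row 0.
Det-firstColumn : ∀ n (M : Rows) →
  Det (suc n) M ≡ ∑ (suc n) (λ i → sgn i ℤ.* (M i 0 ℤ.* Det n (λ i′ j → M (skip i i′) (suc j))))
Det-firstColumn zero    M = trans (Det-suc 0 M) (∑-cong 1 λ { zero _ →
  cong (λ z → 1ℤ ℤ.* (M 0 0 ℤ.* z)) (Det-cong 0 (λ _ _ ())) ; (suc _) (s≤s ()) })
Det-firstColumn (suc n) M = trans (trans (Det-suc (suc n) M) (∑-suc (suc n) _)) (trans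
  (cong (λ z → 1ℤ ℤ.* (M 0 0 ℤ.* Det (suc n) (λ i j → M (suc i) (suc j))) ℤ.+ z) (begin
  ∑ (suc n) (λ j → ℤ.- sgn j ℤ.* (M 0 (suc j) ℤ.* Det (suc n) (λ i l → M (suc i) (skip (suc j) l))))
    ≡⟨ ∑-cong (suc n) (λ j _ → trans
         (cong (λ z → ℤ.- sgn j ℤ.* (M 0 (suc j) ℤ.* z)) (Det-firstColumn n _))
         (pull (sgn j) (M 0 (suc j)) (λ i → sgn i) (λ i → M (suc i) 0) (λ i → D i j))) ⟩
  ∑ (suc n) (λ j → ∑ (suc n) (λ i → ℤ.- sgn j ℤ.* (M 0 (suc j) ℤ.* (sgn i ℤ.* (M (suc i) 0 ℤ.* D i j)))))
    ≡⟨ ∑-swap (suc n) (suc n) _ ⟩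
  ∑ (suc n) (λ i → ∑ (suc n) (λ j → ℤ.- sgn j ℤ.* (M 0 (suc j) ℤ.* (sgn i ℤ.* (M (suc i) 0 ℤ.* D i j)))))
    ≡⟨ ∑-cong (suc n) (λ i _ → ∑-cong (suc n) (λ j _ →
         exchange (sgn j) (M 0 (suc j)) (sgn i) (M (suc i) 0) (D i j))) ⟩
  ∑ (suc n) (λ i → ∑ (suc n) (λ j → ℤ.- sgn i ℤ.* (M (suc i) 0 ℤ.* (sgn j ℤ.* (M 0 (suc j) ℤ.* D i j)))))
    ≡⟨ ∑-cong (suc n) (λ i _ → trans
         (cong (λ z → ℤ.- sgn i ℤ.* (M (suc i) 0 ℤ.* z)) (Det-suc n _))
         (pull (sgn i) (M (suc i) 0) (λ j → sgn j) (λ j → M 0 (suc j)) (λ j → D i j))) ⟨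
  ∑ (suc n) (λ i → ℤ.- sgn i ℤ.* (M (suc i) 0 ℤ.* Det (suc n) (λ i′ j → M (skip (suc i) i′) (suc j))))
    ∎))
  (sym (∑-suc (suc n) _)))
  where
  D : ℕ → ℕ → ℤ
  D i j = Det n (λ i′ l → M (suc (skip i i′)) (suc (skip j l)))

  pull : ∀ s x (f g h : ℕ → ℤ) → ℤ.- s ℤ.* (x ℤ.* ∑ (suc n) (λ i → f i ℤ.* (g i ℤ.* h i)))
    ≡ ∑ (suc n) (λ i → ℤ.- s ℤ.* (x ℤ.* (f i ℤ.* (g i ℤ.* h i))))
  pull s x f g h = trans (cong ((ℤ.- s) ℤ.*_) (∑-distribˡ (suc n) x _)) (∑-distribˡ (suc n) (ℤ.- s) _)

  exchange : ∀ s x t y d → ℤ.- s ℤ.* (x ℤ.* (t ℤ.* (y ℤ.* d))) ≡ ℤ.- t ℤ.* (y ℤ.* (s ℤ.* (x ℤ.* d)))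
  exchange = solve-∀

Det-transpose : ∀ n (M : Rows) → Det n (λ i j → M j i) ≡ Det n M
Det-transpose zero    M = Det-cong 0 (λ _ _ ())
Det-transpose (suc n) M = trans (Det-suc n _) (trans
  (∑-cong (suc n) λ i _ → cong (λ z → sgn i ℤ.* (M i 0 ℤ.* z)) (Det-transpose n (λ i′ j → M (skip i i′) (suc j))))
  (sym (Det-firstColumn n M)))

-- Inserting a row, and the functional it gives

ins : ℕ → Vector → Rows → Rows
ins zero    u R zero    = u
ins zero    u R (suc i) = R i
ins (suc p) u R zero    = R zero
ins (suc p) u R (suc i) = ins p u (R ∘ suc) i

ins-skip : ∀ p (M : Rows) i → M i ≡ ins p (M p) (M ∘ skip p) i
ins-skip zero    M zero    = refl
ins-skip zero    M (suc i) = refl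
ins-skip (suc p) M zero    = refl
ins-skip (suc p) M (suc i) = ins-skip p (M ∘ suc) i

ins-∘ : ∀ p u R (f : ℕ → ℕ) i l → ins p u R i (f l) ≡ ins p (u ∘ f) (λ r → R r ∘ f) i l
ins-∘ zero    u R f zero    l = refl
ins-∘ zero    u R f (suc i) l = refl
ins-∘ (suc p) u R f zero    l = refl
ins-∘ (suc p) u R f (suc i) l = ins-∘ p u (R ∘ suc) f i l

ins-repeat : ∀ q R i → ins (suc q) (R q) R i ≡ ins q (R q) R i
ins-repeat zero    R zero          = refl
ins-repeat zero    R (suc zero)    = refl
ins-repeat zero    R (suc (suc i)) = refl
ins-repeat (suc q) R zero          = refl
ins-repeat (suc q) R (suc i)       = ins-repeat q (R ∘ suc) i

-- Expanding along the first column, the terms of rows 0 and 1 trade places with opposite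
-- signs, and the remaining minors still start with u and v.
Det-swap₀ : ∀ m u v R → Det (2 + m) (ins 0 u (ins 0 v R)) ≡ ℤ.- Det (2 + m) (ins 0 v (ins 0 u R))
Det-swap₀ m u v R = begin
  Det (2 + m) (ins 0 u (ins 0 v R)) ≡⟨ expand u v ⟩
  1ℤ ℤ.* (u 0 ℤ.* D v) ℤ.+ (-1ℤ ℤ.* (v 0 ℤ.* D u) ℤ.+ rest u v)
    ≡⟨ cong (λ z → 1ℤ ℤ.* (u 0 ℤ.* D v) ℤ.+ (-1ℤ ℤ.* (v 0 ℤ.* D u) ℤ.+ z)) (rest-swap m R) ⟩
  1ℤ ℤ.* (u 0 ℤ.* D v) ℤ.+ (-1ℤ ℤ.* (v 0 ℤ.* D u) ℤ.+ (ℤ.- rest v u)) ≡⟨ flip (u 0 ℤ.* D v) (v 0 ℤ.* D u) (rest v u) ⟩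
  ℤ.- (1ℤ ℤ.* (v 0 ℤ.* D u) ℤ.+ (-1ℤ ℤ.* (u 0 ℤ.* D v) ℤ.+ rest v u)) ≡⟨ cong ℤ.-_ (expand v u) ⟨
  ℤ.- Det (2 + m) (ins 0 v (ins 0 u R)) ∎
  where
  D : Vector → ℤ
  D w = Det (suc m) (ins 0 (w ∘ suc) (λ i → R i ∘ suc))

  restOf : ∀ m → Rows → Vector → Vector → ℕ → ℤ
  restOf m R u v i = ℤ.- (ℤ.- sgn i) ℤ.*
    (R i 0 ℤ.* Det (suc m) (ins 0 (u ∘ suc) (ins 0 (v ∘ suc) (λ r → R (skip i r) ∘ suc))))

  rest : Vector → Vector → ℤ
  rest u v = ∑ m (restOf m R u v)

  rest-swap : ∀ m R → ∑ m (restOf m R u v) ≡ ℤ.- ∑ m (restOf m R v u)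
  rest-swap zero    R = trans (∑-zero 0 (λ _ ())) (cong ℤ.-_ (sym (∑-zero 0 (λ _ ()))))
  rest-swap (suc m) R = trans
    (∑-cong (suc m) (λ i _ → trans
      (cong (λ z → ℤ.- (ℤ.- sgn i) ℤ.* (R i 0 ℤ.* z)) (Det-swap₀ m (u ∘ suc) (v ∘ suc) (λ r → R (skip i r) ∘ suc)))
      (negate (ℤ.- (ℤ.- sgn i)) (R i 0) _)))
    (∑-neg (suc m) (restOf (suc m) R v u))
    where
    negate : ∀ s x d → s ℤ.* (x ℤ.* (ℤ.- d)) ≡ ℤ.- (s ℤ.* (x ℤ.* d))
    negate = solve-∀

  flip : ∀ x y r → 1ℤ ℤ.* x ℤ.+ (-1ℤ ℤ.* y ℤ.+ (ℤ.- r)) ≡ ℤ.- (1ℤ ℤ.* y ℤ.+ (-1ℤ ℤ.* x ℤ.+ r))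
  flip = solve-∀

  expand : ∀ u v → Det (2 + m) (ins 0 u (ins 0 v R)) ≡ 1ℤ ℤ.* (u 0 ℤ.* D v) ℤ.+ (-1ℤ ℤ.* (v 0 ℤ.* D u) ℤ.+ rest u v)
  expand u v = begin
    Det (2 + m) M                                   ≡⟨ Det-firstColumn (suc m) M ⟩
    ∑ (2 + m) t                                     ≡⟨ ∑-suc (suc m) t ⟩
    t 0 ℤ.+ ∑ (suc m) (t ∘ suc)                     ≡⟨ cong (λ z → t 0 ℤ.+ z) (∑-suc m (t ∘ suc)) ⟩
    t 0 ℤ.+ (t 1 ℤ.+ ∑ m (λ i → t (2 + i)))
      ≡⟨ cong₂ ℤ._+_
           (cong (λ z → 1ℤ ℤ.* (u 0 ℤ.* z)) (Det-cong (suc m) λ { zero j _ _ → refl ; (suc i) j _ _ → refl }))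
           (cong₂ ℤ._+_
             (cong (λ z → -1ℤ ℤ.* (v 0 ℤ.* z)) (Det-cong (suc m) λ { zero j _ _ → refl ; (suc i) j _ _ → refl }))
             (∑-cong m (λ i _ → cong (λ z → ℤ.- (ℤ.- sgn i) ℤ.* (R i 0 ℤ.* z)) (Det-cong (suc m)
               λ { zero j _ _ → refl ; (suc zero) j _ _ → refl ; (suc (suc r)) j _ _ → refl })))) ⟩
    1ℤ ℤ.* (u 0 ℤ.* D v) ℤ.+ (-1ℤ ℤ.* (v 0 ℤ.* D u) ℤ.+ rest u v) ∎
    where
    M : Rows
    M = ins 0 u (ins 0 v R)

    t : ℕ → ℤ
    t i = sgn i ℤ.* (M i 0 ℤ.* Det (suc m) (λ i′ j → M (skip i i′) (suc j)))

-- Expansion along row 0 lowers p until the two adjacent rows are at the top.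
Det-ins-suc : ∀ n p u R → suc p < n → Det n (ins (suc p) u R) ≡ ℤ.- Det n (ins p u R)
Det-ins-suc (suc (suc m)) zero u R _ = begin
  Det (2 + m) (ins 1 u R)
    ≡⟨ Det-cong (2 + m) (λ { zero j _ _ → refl ; (suc zero) j _ _ → refl ; (suc (suc i)) j _ _ → refl }) ⟩
  Det (2 + m) (ins 0 (R 0) (ins 0 u (R ∘ suc)))
    ≡⟨ Det-swap₀ m (R 0) u (R ∘ suc) ⟩
  ℤ.- Det (2 + m) (ins 0 u (ins 0 (R 0) (R ∘ suc)))
    ≡⟨ cong ℤ.-_ (Det-cong (2 + m) (λ { zero j _ _ → refl ; (suc zero) j _ _ → refl ; (suc (suc i)) j _ _ → refl })) ⟩
  ℤ.- Det (2 + m) (ins 0 u R) ∎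
Det-ins-suc (suc n) (suc p) u R (s≤s p<n) = trans (trans (Det-suc n _)
  (∑-cong (suc n) (λ j _ → trans (cong (λ z → sgn j ℤ.* (R 0 j ℤ.* z)) (minor j)) (negate (sgn j) (R 0 j) _))))
  (trans (∑-neg (suc n) _) (cong ℤ.-_ (sym (Det-suc n _))))
  where
  negate : ∀ s x d → s ℤ.* (x ℤ.* (ℤ.- d)) ≡ ℤ.- (s ℤ.* (x ℤ.* d))
  negate = solve-∀

  minor : ∀ j → Det n (λ i l → ins (suc p) u (R ∘ suc) i (skip j l)) ≡ ℤ.- Det n (λ i l → ins p u (R ∘ suc) i (skip j l))
  minor j = begin
    Det n (λ i l → ins (suc p) u (R ∘ suc) i (skip j l))
      ≡⟨ Det-cong n (λ i l _ _ → ins-∘ (suc p) u (R ∘ suc) (skip j) i l) ⟩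
    Det n (ins (suc p) (u ∘ skip j) (λ r → R (suc r) ∘ skip j))
      ≡⟨ Det-ins-suc n p _ _ p<n ⟩
    ℤ.- Det n (ins p (u ∘ skip j) (λ r → R (suc r) ∘ skip j))
      ≡⟨ cong ℤ.-_ (Det-cong n (λ i l _ _ → ins-∘ p u (R ∘ suc) (skip j) i l)) ⟨
    ℤ.- Det n (λ i l → ins p u (R ∘ suc) i (skip j l)) ∎

Det-ins : ∀ n p u R → p < n → Det n (ins p u R) ≡ sgn p ℤ.* Det n (ins 0 u R)
Det-ins n zero    u R _   = sym (ℤ.*-identityˡ _)
Det-ins n (suc p) u R p<n = begin
  Det n (ins (suc p) u R)            ≡⟨ Det-ins-suc n p u R p<n ⟩
  ℤ.- Det n (ins p u R)              ≡⟨ cong ℤ.-_ (Det-ins n p u R (ℕ.<-trans (ℕ.n<1+n p) p<n)) ⟩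
  ℤ.- (sgn p ℤ.* Det n (ins 0 u R))  ≡⟨ ℤ.neg-distribˡ-* (sgn p) _ ⟩
  sgn (suc p) ℤ.* Det n (ins 0 u R)  ∎

-- `resp` is a field because pointwise equal vectors need not be propositionally equal.
record Linear (G : Vector → ℤ) : Set where
  field
    resp : ∀ {u v : Vector} → (∀ j → u j ≡ v j) → G u ≡ G v
    lin  : ∀ a u v → G (λ j → a ℤ.* u j ℤ.+ v j) ≡ a ℤ.* G u ℤ.+ G v

  add : ∀ u v → G (λ j → u j ℤ.+ v j) ≡ G u ℤ.+ G v
  add u v = begin
    G (λ j → u j ℤ.+ v j)           ≡⟨ resp (λ j → cong (ℤ._+ v j) (ℤ.*-identityˡ (u j))) ⟨
    G (λ j → 1ℤ ℤ.* u j ℤ.+ v j)    ≡⟨ lin 1ℤ u v ⟩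
    1ℤ ℤ.* G u ℤ.+ G v              ≡⟨ cong (ℤ._+ G v) (ℤ.*-identityˡ (G u)) ⟩
    G u ℤ.+ G v                     ∎

  kill-zero : G (λ _ → 0ℤ) ≡ 0ℤ
  kill-zero = begin
    G (λ _ → 0ℤ)                         ≡⟨ lin -1ℤ (λ _ → 0ℤ) (λ _ → 0ℤ) ⟩
    -1ℤ ℤ.* G (λ _ → 0ℤ) ℤ.+ G (λ _ → 0ℤ) ≡⟨ cancel (G (λ _ → 0ℤ)) ⟩
    0ℤ                                   ∎
    where
    cancel : ∀ x → -1ℤ ℤ.* x ℤ.+ x ≡ 0ℤ
    cancel = solve-∀

  neg : ∀ u → G (λ j → ℤ.- u j) ≡ ℤ.- G u
  neg u = begin
    G (λ j → ℤ.- u j)                 ≡⟨ resp (λ j → trans (ℤ.+-identityʳ _) (ℤ.-1*i≡-i (u j))) ⟨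
    G (λ j → -1ℤ ℤ.* u j ℤ.+ 0ℤ)      ≡⟨ lin -1ℤ u (λ _ → 0ℤ) ⟩
    -1ℤ ℤ.* G u ℤ.+ G (λ _ → 0ℤ)      ≡⟨ cong (λ z → (-1ℤ ℤ.* G u) ℤ.+ z) kill-zero ⟩
    -1ℤ ℤ.* G u ℤ.+ 0ℤ                ≡⟨ trans (ℤ.+-identityʳ _) (ℤ.-1*i≡-i (G u)) ⟩
    ℤ.- G u                           ∎

Det-ins-linear : ∀ n p R → p < n → Linear (λ u → Det n (ins p u R))
Det-ins-linear n@(suc m) p R p<n = record
  { resp = λ {u} {v} eq → trans (Det-ins n p u R p<n) (trans (cong (sgn p ℤ.*_)
             (Det-cong n λ { zero j _ _ → eq j ; (suc i) j _ _ → refl })) (sym (Det-ins n p v R p<n)))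
  ; lin  = λ a u v → begin
      Det n (ins p (λ j → a ℤ.* u j ℤ.+ v j) R)
        ≡⟨ Det-ins n p _ R p<n ⟩
      sgn p ℤ.* Det n (ins 0 (λ j → a ℤ.* u j ℤ.+ v j) R)
        ≡⟨ cong (sgn p ℤ.*_) (Det-suc m _) ⟩
      sgn p ℤ.* ∑ n (λ j → sgn j ℤ.* ((a ℤ.* u j ℤ.+ v j) ℤ.* D j))
        ≡⟨ cong (sgn p ℤ.*_) (∑-cong n (λ j _ → distribute (sgn j) a (u j) (v j) (D j))) ⟩
      sgn p ℤ.* ∑ n (λ j → a ℤ.* (sgn j ℤ.* (u j ℤ.* D j)) ℤ.+ sgn j ℤ.* (v j ℤ.* D j))
        ≡⟨ cong (sgn p ℤ.*_) (trans (∑-linear n a _ _) (cong₂ (λ x y → a ℤ.* x ℤ.+ y) (sym (Det-suc m _)) (sym (Det-suc m _)))) ⟩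
      sgn p ℤ.* (a ℤ.* Det n (ins 0 u R) ℤ.+ Det n (ins 0 v R))
        ≡⟨ distribute′ (sgn p) a _ _ ⟩
      a ℤ.* (sgn p ℤ.* Det n (ins 0 u R)) ℤ.+ sgn p ℤ.* Det n (ins 0 v R)
        ≡⟨ cong₂ (λ x y → a ℤ.* x ℤ.+ y) (Det-ins n p u R p<n) (Det-ins n p v R p<n) ⟨
      a ℤ.* Det n (ins p u R) ℤ.+ Det n (ins p v R) ∎
  }
  where
  D : ℕ → ℤ
  D j = Det m (λ i l → R i (skip j l))

  distribute : ∀ s a x y d → s ℤ.* ((a ℤ.* x ℤ.+ y) ℤ.* d) ≡ a ℤ.* (s ℤ.* (x ℤ.* d)) ℤ.+ s ℤ.* (y ℤ.* d)
  distribute = solve-∀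

  distribute′ : ∀ s a x y → s ℤ.* (a ℤ.* x ℤ.+ y) ≡ a ℤ.* (s ℤ.* x) ℤ.+ s ℤ.* y
  distribute′ = solve-∀

i≡-i⇒i≡0 : ∀ {i} → i ≡ ℤ.- i → i ≡ 0ℤ
i≡-i⇒i≡0 {+ zero} _ = refl

-- Inserted next to its twin, the row can trade places with it without changing the matrix, so the
-- determinant equals its own negative. The bound on q keeps both copies inside the corner.
Det-ins-repeat : ∀ n p q R → p < n → suc q < n → Det n (ins p (R q) R) ≡ 0ℤ
Det-ins-repeat n p q R p<n 1+q<n = begin
  Det n (ins p (R q) R)                         ≡⟨ Det-ins n p (R q) R p<n ⟩
  sgn p ℤ.* Det n (ins 0 (R q) R)               ≡⟨ cong (sgn p ℤ.*_) at-top ⟩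
  sgn p ℤ.* 0ℤ                                  ≡⟨ ℤ.*-zeroʳ (sgn p) ⟩
  0ℤ                                            ∎
  where
  q<n = ℕ.<-trans (ℕ.n<1+n q) 1+q<n

  at-q : Det n (ins q (R q) R) ≡ 0ℤ
  at-q = i≡-i⇒i≡0 (trans
    (Det-cong n (λ i j _ _ → sym (cong (λ w → w j) (ins-repeat q R i))))
    (Det-ins-suc n q (R q) R 1+q<n))

  at-top : Det n (ins 0 (R q) R) ≡ 0ℤ
  at-top = begin
    Det n (ins 0 (R q) R)                          ≡⟨ ℤ.*-identityˡ _ ⟨
    1ℤ ℤ.* Det n (ins 0 (R q) R)                   ≡⟨ cong (ℤ._* Det n (ins 0 (R q) R)) (sgn-square q) ⟨
    sgn q ℤ.* sgn q ℤ.* Det n (ins 0 (R q) R)      ≡⟨ ℤ.*-assoc (sgn q) (sgn q) _ ⟩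
    sgn q ℤ.* (sgn q ℤ.* Det n (ins 0 (R q) R))    ≡⟨ cong (sgn q ℤ.*_) (Det-ins n q (R q) R q<n) ⟨
    sgn q ℤ.* Det n (ins q (R q) R)                ≡⟨ cong (sgn q ℤ.*_) at-q ⟩
    sgn q ℤ.* 0ℤ                                   ≡⟨ ℤ.*-zeroʳ (sgn q) ⟩
    0ℤ                                             ∎

-- Triangular changes of basis

-- Stage c in replacing the rows of r by those of y from the top down.
mix : ℕ → Rows → Rows → Rows
mix zero    y r i       = r i
mix (suc c) y r zero    = y zero
mix (suc c) y r (suc i) = mix c (y ∘ suc) (r ∘ suc) i

mix-below : ∀ c y r i → i < c → mix c y r i ≡ y i
mix-below (suc c) y r zero    _         = refl
mix-below (suc c) y r (suc i) (s≤s i<c) = mix-below c (y ∘ suc) (r ∘ suc) i i<c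

mix-ins : ∀ c y r i → mix c y r i ≡ ins c (r c) (mix c y r ∘ skip c) i
mix-ins zero    y r zero    = refl
mix-ins zero    y r (suc i) = refl
mix-ins (suc c) y r zero    = refl
mix-ins (suc c) y r (suc i) = mix-ins c (y ∘ suc) (r ∘ suc) i

mix-suc-ins : ∀ c y r i → mix (suc c) y r i ≡ ins c (y c) (mix c y r ∘ skip c) i
mix-suc-ins zero    y r zero    = refl
mix-suc-ins zero    y r (suc i) = refl
mix-suc-ins (suc c) y r zero    = refl
mix-suc-ins (suc c) y r (suc i) = mix-suc-ins c (y ∘ suc) (r ∘ suc) i

-- The hypothesis says that r c − y c lies in the span of y 0 , … , y (c − 1).
Det-triangular : ∀ n (y r : Rows) →
  (∀ c G → Linear G → (∀ i → i < c → G (y i) ≡ 0ℤ) → G (r c) ≡ G (y c)) →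
  Det n r ≡ Det n y
Det-triangular n y r hyp = begin
  Det n r            ≡⟨ mixed n ℕ.≤-refl ⟨
  Det n (mix n y r)  ≡⟨ Det-cong n (λ i j i<n _ → cong (λ w → w j) (mix-below n y r i i<n)) ⟩
  Det n y            ∎
  where
  mixed : ∀ c → c ≤ n → Det n (mix c y r) ≡ Det n r
  mixed zero    _   = refl
  mixed (suc c) c<n = begin
    Det n (mix (suc c) y r) ≡⟨ Det-cong n (λ i j _ _ → cong (λ w → w j) (mix-suc-ins c y r i)) ⟩
    Det n (ins c (y c) R)   ≡⟨ hyp c _ (Det-ins-linear n c R c<n) kills ⟨
    Det n (ins c (r c) R)   ≡⟨ Det-cong n (λ i j _ _ → cong (λ w → w j) (mix-ins c y r i)) ⟨
    Det n (mix c y r)       ≡⟨ mixed c (ℕ.<⇒≤ c<n) ⟩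
    Det n r                 ∎
    where
    R : Rows
    R = mix c y r ∘ skip c

    -- At this stage `y i` already stands in row i, so putting it into row c repeats a row.
    kills : ∀ i → i < c → Det n (ins c (y i) R) ≡ 0ℤ
    kills i i<c = subst (λ w → Det n (ins c w R) ≡ 0ℤ)
      (trans (cong (mix c y r) (skip-below c i i<c)) (mix-below c y r i i<c))
      (Det-ins-repeat n c i R c<n (ℕ.≤-<-trans i<c c<n))

-- The hypothesis says that F (y j) − y (suc j) lies in the span of y 0 , … , y j.
Det-krylov : ∀ n (F : Vector → Vector) (y : Rows) →
  (∀ {G} → Linear G → Linear (G ∘ F)) →
  (∀ j G → Linear G → (∀ i → i ≤ j → G (y i) ≡ 0ℤ) → G (F (y j)) ≡ G (y (suc j))) →
  Det n (fold (y 0) F) ≡ Det n y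
Det-krylov n F y linear-F step = Det-triangular n y (fold (y 0) F) powers
  where
  powers : ∀ c G → Linear G → (∀ i → i < c → G (y i) ≡ 0ℤ) → G (fold (y 0) F c) ≡ G (y c)
  powers zero    G lin kills = refl
  -- The outermost F is absorbed into the functional. G ∘ F still kills y i for i < c, because F (y
  -- i) is y (i+1) up to killed vectors.
  powers (suc c) G lin kills = trans
    (powers c (G ∘ F) (linear-F lin) λ i i<c →
      trans (step i G lin λ l l≤i → kills l (s≤s (ℕ.≤-trans l≤i (ℕ.<⇒≤ i<c)))) (kills (suc i) (s<s i<c)))
    (step c G lin λ i i≤c → kills i (s≤s i≤c))

-- Removing a last row or column with a single entry

Det-unitRow : ∀ n p c (M : Rows) → p ≤ n → (∀ j → j ≤ n → M n j ≡ c ℤ.* e p j) →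
  Det (suc n) M ≡ sgn n ℤ.* (sgn p ℤ.* (c ℤ.* Det n (λ i j → M i (skip p j))))
Det-unitRow n p c M p≤n unit = begin
  Det (suc n) M                                    ≡⟨ Det-cong (suc n) (λ i j _ _ → cong (λ w → w j) (ins-skip n M i)) ⟩
  Det (suc n) (ins n (M n) R)                      ≡⟨ Det-ins (suc n) n (M n) R ℕ.≤-refl ⟩
  sgn n ℤ.* Det (suc n) (ins 0 (M n) R)            ≡⟨ cong (sgn n ℤ.*_) (Det-suc n (ins 0 (M n) R)) ⟩
  sgn n ℤ.* ∑ (suc n) (λ j → sgn j ℤ.* (M n j ℤ.* D j))
    ≡⟨ cong (sgn n ℤ.*_) (∑-cong (suc n) λ j j≤n →
         trans (cong (λ z → sgn j ℤ.* (z ℤ.* D j)) (unit j (ℕ.≤-pred j≤n))) (rearrange (sgn j) c (e p j) (D j))) ⟩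
  sgn n ℤ.* ∑ (suc n) (λ j → sgn j ℤ.* (c ℤ.* D j) ℤ.* e p j)
    ≡⟨ cong (sgn n ℤ.*_) (∑-pick (suc n) p (λ j → sgn j ℤ.* (c ℤ.* D j)) (s≤s p≤n)) ⟩
  sgn n ℤ.* (sgn p ℤ.* (c ℤ.* D p))
    ≡⟨ cong (λ z → sgn n ℤ.* (sgn p ℤ.* (c ℤ.* z))) (Det-cong n λ i j i<n _ →
         cong (λ r → M r (skip p j)) (skip-below n i i<n)) ⟩
  sgn n ℤ.* (sgn p ℤ.* (c ℤ.* Det n (λ i j → M i (skip p j)))) ∎
  where
  R : Rows
  R = M ∘ skip n

  D : ℕ → ℤ
  D j = Det n (λ i l → R i (skip j l))

  rearrange : ∀ s c x d → s ℤ.* (c ℤ.* x ℤ.* d) ≡ s ℤ.* (c ℤ.* d) ℤ.* x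
  rearrange = solve-∀

Det-unitColumn : ∀ n p c (M : Rows) → p ≤ n → (∀ i → i ≤ n → M i n ≡ c ℤ.* e p i) →
  Det (suc n) M ≡ sgn n ℤ.* (sgn p ℤ.* (c ℤ.* Det n (λ i j → M (skip p i) j)))
Det-unitColumn n p c M p≤n unit = begin
  Det (suc n) M
    ≡⟨ Det-transpose (suc n) M ⟨
  Det (suc n) (λ i j → M j i)
    ≡⟨ Det-unitRow n p c (λ i j → M j i) p≤n unit ⟩
  sgn n ℤ.* (sgn p ℤ.* (c ℤ.* Det n (λ i j → M (skip p j) i)))
    ≡⟨ cong (λ z → sgn n ℤ.* (sgn p ℤ.* (c ℤ.* z))) (Det-transpose n (λ i j → M (skip p i) j)) ⟩
  sgn n ℤ.* (sgn p ℤ.* (c ℤ.* Det n (λ i j → M (skip p i) j))) ∎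

-- The Jacobi operator

-- Two steps of a non-negative lattice path, index j standing for height 2j. Height 0 has only one
-- two-step return instead of two; equivalently, the general rule is applied with the entry at -1
-- equal to minus the entry at 0.
J : Vector → Vector
J u zero    = u 0 ℤ.+ u 1
J u (suc j) = u j ℤ.+ (+ 2 ℤ.* u (suc j) ℤ.+ u (2 + j))

J-cong : ∀ {u v : Vector} → (∀ j → u j ≡ v j) → ∀ j → J u j ≡ J v j
J-cong eq zero    = cong₂ ℤ._+_ (eq 0) (eq 1)
J-cong eq (suc j) = cong₂ ℤ._+_ (eq j) (cong₂ (λ x y → + 2 ℤ.* x ℤ.+ y) (eq (suc j)) (eq (2 + j)))

J-linear : ∀ a u v j → J (λ j → a ℤ.* u j ℤ.+ v j) j ≡ a ℤ.* J u j ℤ.+ J v j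
J-linear a u v zero    = rearrange a (u 0) (u 1) (v 0) (v 1)
  where
  rearrange : ∀ a x x′ y y′ → a ℤ.* x ℤ.+ y ℤ.+ (a ℤ.* x′ ℤ.+ y′) ≡ a ℤ.* (x ℤ.+ x′) ℤ.+ (y ℤ.+ y′)
  rearrange = solve-∀
J-linear a u v (suc j) = rearrange a (u j) (u (suc j)) (u (2 + j)) (v j) (v (suc j)) (v (2 + j))
  where
  rearrange : ∀ a x x′ x″ y y′ y″ →
    a ℤ.* x ℤ.+ y ℤ.+ (+ 2 ℤ.* (a ℤ.* x′ ℤ.+ y′) ℤ.+ (a ℤ.* x″ ℤ.+ y″))
    ≡ a ℤ.* (x ℤ.+ (+ 2 ℤ.* x′ ℤ.+ x″)) ℤ.+ (y ℤ.+ (+ 2 ℤ.* y′ ℤ.+ y″))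
  rearrange = solve-∀

Linear-∘J : ∀ {G} → Linear G → Linear (G ∘ J)
Linear-∘J linear = record
  { resp = λ eq → resp (J-cong eq)
  ; lin  = λ a u v → trans (resp (J-linear a u v)) (lin a (J u) (J v))
  }
  where open Linear linear

Linear-lookup : ∀ j → Linear (λ u → u j)
Linear-lookup j = record { resp = λ eq → eq j ; lin = λ a u v → refl }

J-+ : ∀ u v j → J (λ j → u j ℤ.+ v j) j ≡ J u j ℤ.+ J v j
J-+ u v j = Linear.add (Linear-∘J (Linear-lookup j)) u v

J-neg : ∀ u j → J (λ j → ℤ.- u j) j ≡ ℤ.- J u j
J-neg u j = Linear.neg (Linear-∘J (Linear-lookup j)) u

J-e₀ : ∀ j → J (e 0) j ≡ e 0 j ℤ.+ e 1 j
J-e₀ zero          = refl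
J-e₀ (suc zero)    = refl
J-e₀ (suc (suc j)) = refl

J-e : ∀ p j → J (e (suc p)) j ≡ e p j ℤ.+ (+ 2 ℤ.* e (suc p) j ℤ.+ e (2 + p) j)
J-e p zero    = trans (ℤ.+-identityˡ (e p 0)) (sym (ℤ.+-identityʳ (e p 0)))
J-e p (suc j) = reverse (e (suc p) j) (e p j) (e p (suc j))
  where
  reverse : ∀ x y z → x ℤ.+ (+ 2 ℤ.* y ℤ.+ z) ≡ z ℤ.+ (+ 2 ℤ.* y ℤ.+ x)
  reverse = solve-∀

-- With e extended to negative indices by e (-1 - r) = - e r, this is e (K - 1 - r).
reflected : ℕ → ℕ → Vector
reflected zero    r       = λ j → ℤ.- e r j
reflected (suc K) zero    = e K
reflected (suc K) (suc r) = reflected K r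

-- The general three-term rule, with `e K` in the place of `reflected K (-1)`. The sign convention
-- for negative indices absorbs the boundary of `J`.
J-reflected₀ : ∀ K j → J (reflected K 0) j ≡ e K j ℤ.+ (+ 2 ℤ.* reflected K 0 j ℤ.+ reflected K 1 j)
J-reflected₀ zero          j = trans (J-neg (e 0) j) (trans (cong ℤ.-_ (J-e₀ j)) (rearrange (e 0 j) (e 1 j)))
  where
  rearrange : ∀ x y → ℤ.- (x ℤ.+ y) ≡ x ℤ.+ (+ 2 ℤ.* (ℤ.- x) ℤ.+ (ℤ.- y))
  rearrange = solve-∀
J-reflected₀ (suc zero)    j = trans (J-e₀ j) (rearrange (e 0 j) (e 1 j))
  where
  rearrange : ∀ x y → x ℤ.+ y ≡ y ℤ.+ (+ 2 ℤ.* x ℤ.+ (ℤ.- x))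
  rearrange = solve-∀
J-reflected₀ (suc (suc K)) j = trans (J-e K j) (reverse (e K j) (e (suc K) j) (e (2 + K) j))
  where
  reverse : ∀ x y z → x ℤ.+ (+ 2 ℤ.* y ℤ.+ z) ≡ z ℤ.+ (+ 2 ℤ.* y ℤ.+ x)
  reverse = solve-∀

J-reflected : ∀ K r j → J (reflected K (suc r)) j
  ≡ reflected K r j ℤ.+ (+ 2 ℤ.* reflected K (suc r) j ℤ.+ reflected K (2 + r) j)
J-reflected zero    r       j = trans (J-neg (e (suc r)) j)
  (trans (cong ℤ.-_ (J-e r j)) (rearrange (e r j) (e (suc r) j) (e (2 + r) j)))
  where
  rearrange : ∀ x y z → ℤ.- (x ℤ.+ (+ 2 ℤ.* y ℤ.+ z)) ≡ ℤ.- x ℤ.+ (+ 2 ℤ.* (ℤ.- y) ℤ.+ (ℤ.- z))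
  rearrange = solve-∀
J-reflected (suc K) zero    j = J-reflected₀ K j
J-reflected (suc K) (suc r) j = J-reflected K r j

S : ℕ → Rows
S K r j = e (r + K) j ℤ.+ reflected K r j

-- The coefficient is 3 = 2 + 1 because S (-1) would be e (K-1) + e K, which is S 0 again.
J-S₀ : ∀ k j → J (S (suc k) 0) j ≡ + 3 ℤ.* S (suc k) 0 j ℤ.+ S (suc k) 1 j
J-S₀ k j = begin
  J (S (suc k) 0) j
    ≡⟨ J-+ (e (suc k)) (reflected (suc k) 0) j ⟩
  J (e (suc k)) j ℤ.+ J (reflected (suc k) 0) j
    ≡⟨ cong₂ ℤ._+_ (J-e k j) (J-reflected₀ (suc k) j) ⟩
  e k j ℤ.+ (+ 2 ℤ.* e (suc k) j ℤ.+ e (2 + k) j)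
    ℤ.+ (e (suc k) j ℤ.+ (+ 2 ℤ.* e k j ℤ.+ reflected (suc k) 1 j))
    ≡⟨ rearrange (e k j) (e (suc k) j) (e (2 + k) j) (reflected (suc k) 1 j) ⟩
  + 3 ℤ.* S (suc k) 0 j ℤ.+ S (suc k) 1 j ∎
  where
  rearrange : ∀ x y z w → x ℤ.+ (+ 2 ℤ.* y ℤ.+ z) ℤ.+ (y ℤ.+ (+ 2 ℤ.* x ℤ.+ w)) ≡ + 3 ℤ.* (y ℤ.+ x) ℤ.+ (z ℤ.+ w)
  rearrange = solve-∀

J-S : ∀ K r j → J (S K (suc r)) j ≡ + 2 ℤ.* S K (suc r) j ℤ.+ (S K r j ℤ.+ S K (2 + r) j)
J-S K r j = begin
  J (S K (suc r)) j
    ≡⟨ J-+ (e (suc r + K)) (reflected K (suc r)) j ⟩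
  J (e (suc r + K)) j ℤ.+ J (reflected K (suc r)) j
    ≡⟨ cong₂ ℤ._+_ (J-e (r + K) j) (J-reflected K r j) ⟩
  e (r + K) j ℤ.+ (+ 2 ℤ.* e (suc r + K) j ℤ.+ e (2 + r + K) j)
    ℤ.+ (reflected K r j ℤ.+ (+ 2 ℤ.* reflected K (suc r) j ℤ.+ reflected K (2 + r) j))
    ≡⟨ rearrange (e (r + K) j) (e (suc r + K) j) (e (2 + r + K) j) _ _ _ ⟩
  + 2 ℤ.* S K (suc r) j ℤ.+ (S K r j ℤ.+ S K (2 + r) j) ∎
  where
  rearrange : ∀ x y z x′ y′ z′ → x ℤ.+ (+ 2 ℤ.* y ℤ.+ z) ℤ.+ (x′ ℤ.+ (+ 2 ℤ.* y′ ℤ.+ z′))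
    ≡ + 2 ℤ.* (y ℤ.+ y′) ℤ.+ (x ℤ.+ x′ ℤ.+ (z ℤ.+ z′))
  rearrange = solve-∀

-- For K ≥ 1 this is the solution x of J x = S 0 with x 0 = 0. The prescribed (0,0)-entry fixes x 0,
-- and the equation then determines the other entries one after the other.
alternating : ℕ → Vector
alternating zero    j       = sgn j
alternating (suc K) zero    = 0ℤ
alternating (suc K) (suc j) = alternating K j

J-alternating : ∀ k j → J (alternating (suc k)) j ≡ S (suc k) 0 j
J-alternating zero    zero                = refl
J-alternating zero    (suc zero)          = refl
J-alternating zero    (suc (suc zero))    = refl
J-alternating zero    (suc (suc (suc j))) = cancel (sgn j)
  where
  cancel : ∀ x → ℤ.- x ℤ.+ (+ 2 ℤ.* (ℤ.- ℤ.- x) ℤ.+ (ℤ.- ℤ.- ℤ.- x)) ≡ 0ℤ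
  cancel = solve-∀
J-alternating (suc k) zero                = refl
J-alternating (suc k) (suc zero)          = trans (ℤ.+-identityˡ _) (J-alternating k zero)
J-alternating (suc k) (suc (suc j))       = J-alternating k (suc j)

T : ℕ → Rows
T K = ins 0 (alternating K) (S K)

X : ℕ → Rows
X K = fold (alternating K) J

Det-X : ∀ n k → Det n (X (suc k)) ≡ Det n (T (suc k))
Det-X n k = Det-krylov n J (T (suc k)) Linear-∘J step
  where
  step : ∀ j G → Linear G → (∀ i → i ≤ j → G (T (suc k) i) ≡ 0ℤ) → G (J (T (suc k) j)) ≡ G (T (suc k) (suc j))
  step zero          G linear kills = Linear.resp linear (J-alternating k)
  step (suc zero)    G linear kills = begin
    G (J (S (suc k) 0))                         ≡⟨ resp (J-S₀ k) ⟩
    G (λ j → + 3 ℤ.* S (suc k) 0 j ℤ.+ S (suc k) 1 j) ≡⟨ lin (+ 3) (S (suc k) 0) (S (suc k) 1) ⟩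
    + 3 ℤ.* G (S (suc k) 0) ℤ.+ G (S (suc k) 1) ≡⟨ cong (λ z → + 3 ℤ.* z ℤ.+ G (S (suc k) 1)) (kills 1 ℕ.≤-refl) ⟩
    0ℤ ℤ.+ G (S (suc k) 1)                      ≡⟨ ℤ.+-identityˡ _ ⟩
    G (S (suc k) 1)                             ∎
    where open Linear linear
  step (suc (suc r)) G linear kills = begin
    G (J (S (suc k) (suc r)))
      ≡⟨ resp (J-S (suc k) r) ⟩
    G (λ j → + 2 ℤ.* S (suc k) (suc r) j ℤ.+ (S (suc k) r j ℤ.+ S (suc k) (2 + r) j))
      ≡⟨ lin (+ 2) (S (suc k) (suc r)) (λ j → S (suc k) r j ℤ.+ S (suc k) (2 + r) j) ⟩
    + 2 ℤ.* G (S (suc k) (suc r)) ℤ.+ G (λ j → S (suc k) r j ℤ.+ S (suc k) (2 + r) j)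
      ≡⟨ cong₂ (λ x y → + 2 ℤ.* x ℤ.+ y) (kills (2 + r) ℕ.≤-refl) (add (S (suc k) r) (S (suc k) (2 + r))) ⟩
    0ℤ ℤ.+ (G (S (suc k) r) ℤ.+ G (S (suc k) (2 + r)))
      ≡⟨ cong (λ z → 0ℤ ℤ.+ (z ℤ.+ G (S (suc k) (2 + r)))) (kills (suc r) (ℕ.n≤1+n _)) ⟩
    0ℤ ℤ.+ (0ℤ ℤ.+ G (S (suc k) (2 + r)))
      ≡⟨ trans (ℤ.+-identityˡ _) (ℤ.+-identityˡ _) ⟩
    G (S (suc k) (2 + r)) ∎
    where open Linear linear

-- The Hankel matrix and the powers of `J`

shift : Vector → Vector
shift u i = u (suc i)

fold-shift : ∀ j (u : Vector) i → fold u shift j i ≡ u (j + i)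
fold-shift zero    u i = refl
fold-shift (suc j) u i = trans (fold-shift j u (suc i)) (cong u (ℕ.+-suc j i))

-- Row i of the Hankel matrix is column 0 of `X K`, shifted i times. Shifting a column of `X K`
-- applies `J` to every row, which gives a combination of the neighbouring columns with coefficient
-- 1 at the next one.
Det-hankel : ∀ n K → Det n (λ i j → X K (i + j) 0) ≡ Det n (X K)
Det-hankel n K = begin
  Det n (λ i j → X K (i + j) 0)  ≡⟨ Det-cong n (λ i j _ _ → fold-shift i (λ l → X K l 0) j) ⟨
  Det n (fold (y 0) shift)       ≡⟨ Det-krylov n shift y Linear-∘shift step ⟩
  Det n y                        ≡⟨ Det-transpose n (X K) ⟩
  Det n (X K)                    ∎
  where
  y : Rows
  y j i = X K i j

  Linear-∘shift : ∀ {G} → Linear G → Linear (G ∘ shift)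
  Linear-∘shift linear = record
    { resp = λ eq → Linear.resp linear (λ j → eq (suc j))
    ; lin  = λ a u v → Linear.lin linear a (shift u) (shift v)
    }

  step : ∀ j G → Linear G → (∀ i → i ≤ j → G (y i) ≡ 0ℤ) → G (shift (y j)) ≡ G (y (suc j))
  step zero    G linear kills = begin
    G (λ i → y 0 i ℤ.+ y 1 i)   ≡⟨ add (y 0) (y 1) ⟩
    G (y 0) ℤ.+ G (y 1)         ≡⟨ cong (ℤ._+ G (y 1)) (kills 0 z≤n) ⟩
    0ℤ ℤ.+ G (y 1)              ≡⟨ ℤ.+-identityˡ _ ⟩
    G (y 1)                     ∎
    where open Linear linear
  step (suc j) G linear kills = begin
    G (λ i → y j i ℤ.+ (+ 2 ℤ.* y (suc j) i ℤ.+ y (2 + j) i))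
      ≡⟨ add (y j) (λ i → + 2 ℤ.* y (suc j) i ℤ.+ y (2 + j) i) ⟩
    G (y j) ℤ.+ G (λ i → + 2 ℤ.* y (suc j) i ℤ.+ y (2 + j) i)
      ≡⟨ cong₂ ℤ._+_ (kills j (ℕ.n≤1+n j)) (lin (+ 2) (y (suc j)) (y (2 + j))) ⟩
    0ℤ ℤ.+ (+ 2 ℤ.* G (y (suc j)) ℤ.+ G (y (2 + j)))
      ≡⟨ cong (λ z → 0ℤ ℤ.+ (+ 2 ℤ.* z ℤ.+ G (y (2 + j)))) (kills (suc j) ℕ.≤-refl) ⟩
    0ℤ ℤ.+ (0ℤ ℤ.+ G (y (2 + j)))
      ≡⟨ trans (ℤ.+-identityˡ _) (ℤ.+-identityˡ _) ⟩
    G (y (2 + j)) ∎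
    where open Linear linear

-- Moments

odd : ℕ → ℕ
odd zero    = 1
odd (suc m) = 2 + odd m

odd≡ : ∀ m → odd m ≡ m + suc m
odd≡ zero    = refl
odd≡ (suc m) = cong suc (trans (cong suc (odd≡ m)) (sym (ℕ.+-suc m (suc m))))

odd-central : ∀ m → odd m C m ≡ odd m C suc m
odd-central m = trans (nCk≡nC[n∸k] (subst (m ≤_) (sym (odd≡ m)) (ℕ.m≤m+n m (suc m))))
  (cong (odd m C_) (trans (cong (_∸ m) (odd≡ m)) (ℕ.m+n∸m≡n m (suc m))))

pascal² : ∀ n k → + ((2 + n) C (2 + k)) ≡ + (n C k) ℤ.+ (+ 2 ℤ.* + (n C suc k) ℤ.+ + (n C (2 + k)))
pascal² n k = begin
  + ((2 + n) C (2 + k))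
    ≡⟨ cong +_ (nCk+nC[k+1]≡[n+1]C[k+1] (suc n) (suc k)) ⟨
  + (suc n C suc k) ℤ.+ + (suc n C (2 + k))
    ≡⟨ cong₂ (λ x y → + x ℤ.+ + y) (nCk+nC[k+1]≡[n+1]C[k+1] n k) (nCk+nC[k+1]≡[n+1]C[k+1] n (suc k)) ⟨
  + (n C k) ℤ.+ + (n C suc k) ℤ.+ (+ (n C suc k) ℤ.+ + (n C (2 + k)))
    ≡⟨ rearrange (+ (n C k)) (+ (n C suc k)) (+ (n C (2 + k))) ⟩
  + (n C k) ℤ.+ (+ 2 ℤ.* + (n C suc k) ℤ.+ + (n C (2 + k))) ∎
  where
  rearrange : ∀ x y z → x ℤ.+ y ℤ.+ (y ℤ.+ z) ≡ x ℤ.+ (+ 2 ℤ.* y ℤ.+ z)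
  rearrange = solve-∀

-- The number of non-negative lattice paths from height 0 to height 2k+1 with 2m+1 steps.
ballot : ℕ → ℕ → ℤ
ballot m k = + (odd m C suc (m + k)) ℤ.- + (odd m C (2 + (m + k)))

-- The first difference is the ballot number for k - 1, written out so that k = 0 is covered; there
-- it vanishes, being the difference of the two central binomials.
ballot-suc : ∀ m k → ballot (suc m) k ≡
  + (odd m C (m + k)) ℤ.- + (odd m C suc (m + k)) ℤ.+ (+ 2 ℤ.* ballot m k ℤ.+ ballot m (suc k))
ballot-suc m k rewrite ℕ.+-suc m k = trans
  (cong₂ ℤ._-_ (pascal² (odd m) (m + k)) (pascal² (odd m) (suc (m + k))))
  (rearrange (+ (odd m C (m + k))) (+ (odd m C suc (m + k))) (+ (odd m C (2 + (m + k)))) (+ (odd m C (3 + (m + k)))))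
  where
  rearrange : ∀ x y z w → x ℤ.+ (+ 2 ℤ.* y ℤ.+ z) ℤ.- (y ℤ.+ (+ 2 ℤ.* z ℤ.+ w))
    ≡ x ℤ.- y ℤ.+ (+ 2 ℤ.* (y ℤ.- z) ℤ.+ (z ℤ.- w))
  rearrange = solve-∀

Linear-iterate : ∀ m → Linear (λ u → iterate J u m 0)
Linear-iterate zero    = Linear-lookup 0
Linear-iterate (suc m) = Linear-∘J (Linear-iterate m)

-- `iterate` exposes the innermost `J`. Its value at S K 0 is S (K-1) 0 + 2 S K 0 + S (K+1) 0, with
-- S 0 0 = 0, which is the recurrence of `ballot` in k.
iterate-S₀ : ∀ m k → iterate J (S (suc k) 0) m 0 ≡ ballot m k
iterate-S₀ zero zero    = refl
iterate-S₀ zero (suc k) = sym (cong₂ (λ x y → + x ℤ.- + y)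
  (k>n⇒nCk≡0 {1} {2 + k} (s≤s (s≤s z≤n))) (k>n⇒nCk≡0 {1} {3 + k} (s≤s (s≤s z≤n))))
iterate-S₀ (suc m) zero = begin
  φ (J (S 1 0))                                    ≡⟨ resp J-S₁₀ ⟩
  φ (λ j → + 2 ℤ.* S 1 0 j ℤ.+ S 2 0 j)            ≡⟨ lin (+ 2) (S 1 0) (S 2 0) ⟩
  + 2 ℤ.* φ (S 1 0) ℤ.+ φ (S 2 0)                  ≡⟨ cong₂ (λ x y → + 2 ℤ.* x ℤ.+ y) (iterate-S₀ m 0) (iterate-S₀ m 1) ⟩
  + 2 ℤ.* ballot m 0 ℤ.+ ballot m 1                ≡⟨ ℤ.+-identityˡ _ ⟨
  0ℤ ℤ.+ (+ 2 ℤ.* ballot m 0 ℤ.+ ballot m 1)       ≡⟨ cong (ℤ._+ (+ 2 ℤ.* ballot m 0 ℤ.+ ballot m 1)) central ⟨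
  + (odd m C (m + 0)) ℤ.- + (odd m C suc (m + 0)) ℤ.+ (+ 2 ℤ.* ballot m 0 ℤ.+ ballot m 1) ≡⟨ ballot-suc m 0 ⟨
  ballot (suc m) 0                                 ∎
  where
  open Linear (Linear-iterate m)
  φ : Vector → ℤ
  φ u = iterate J u m 0

  central : + (odd m C (m + 0)) ℤ.- + (odd m C suc (m + 0)) ≡ 0ℤ
  central rewrite ℕ.+-identityʳ m = trans (cong (λ x → + x ℤ.- + (odd m C suc m)) (odd-central m))
    (ℤ.+-inverseʳ (+ (odd m C suc m)))

  J-S₁₀ : ∀ j → J (S 1 0) j ≡ + 2 ℤ.* S 1 0 j ℤ.+ S 2 0 j
  J-S₁₀ j = trans (J-+ (e 1) (e 0) j)
    (trans (cong₂ ℤ._+_ (J-e 0 j) (J-e₀ j)) (rearrange (e 0 j) (e 1 j) (e 2 j)))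
    where
    rearrange : ∀ x y z → x ℤ.+ (+ 2 ℤ.* y ℤ.+ z) ℤ.+ (x ℤ.+ y) ≡ + 2 ℤ.* (y ℤ.+ x) ℤ.+ (z ℤ.+ y)
    rearrange = solve-∀
iterate-S₀ (suc m) (suc k) = begin
  φ (J (u (suc k)))                                                ≡⟨ resp J-u ⟩
  φ (λ j → u k j ℤ.+ (+ 2 ℤ.* u (suc k) j ℤ.+ u (2 + k) j))         ≡⟨ add (u k) _ ⟩
  φ (u k) ℤ.+ φ (λ j → + 2 ℤ.* u (suc k) j ℤ.+ u (2 + k) j)         ≡⟨ cong (λ z → φ (u k) ℤ.+ z) (lin (+ 2) (u (suc k)) (u (2 + k))) ⟩
  φ (u k) ℤ.+ (+ 2 ℤ.* φ (u (suc k)) ℤ.+ φ (u (2 + k)))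
    ≡⟨ cong₂ ℤ._+_ (iterate-S₀ m k) (cong₂ (λ x y → + 2 ℤ.* x ℤ.+ y) (iterate-S₀ m (suc k)) (iterate-S₀ m (2 + k))) ⟩
  ballot m k ℤ.+ (+ 2 ℤ.* ballot m (suc k) ℤ.+ ballot m (2 + k))
    ≡⟨ cong (ℤ._+ (+ 2 ℤ.* ballot m (suc k) ℤ.+ ballot m (2 + k)))
         (cong (λ i → + (odd m C i) ℤ.- + (odd m C suc i)) (ℕ.+-suc m k)) ⟨
  + (odd m C (m + suc k)) ℤ.- + (odd m C suc (m + suc k)) ℤ.+ (+ 2 ℤ.* ballot m (suc k) ℤ.+ ballot m (2 + k))
    ≡⟨ ballot-suc m (suc k) ⟨
  ballot (suc m) (suc k) ∎
  where
  open Linear (Linear-iterate m)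
  φ : Vector → ℤ
  φ u = iterate J u m 0

  u : ℕ → Vector
  u k = S (suc k) 0

  J-u : ∀ j → J (u (suc k)) j ≡ u k j ℤ.+ (+ 2 ℤ.* u (suc k) j ℤ.+ u (2 + k) j)
  J-u j = trans (J-+ (e (2 + k)) (e (suc k)) j)
    (trans (cong₂ ℤ._+_ (J-e (suc k) j) (J-e k j)) (rearrange (e k j) (e (suc k) j) (e (2 + k) j) (e (3 + k) j)))
    where
    rearrange : ∀ x y z w → y ℤ.+ (+ 2 ℤ.* z ℤ.+ w) ℤ.+ (x ℤ.+ (+ 2 ℤ.* y ℤ.+ z))
      ≡ y ℤ.+ x ℤ.+ (+ 2 ℤ.* (z ℤ.+ y) ℤ.+ (w ℤ.+ z))
    rearrange = solve-∀

X-ballot : ∀ m k → X (suc k) (suc m) 0 ≡ ballot m k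
X-ballot m k = begin
  X (suc k) (suc m) 0                            ≡⟨ cong (λ u → u 0) (iterate-is-fold (alternating (suc k)) J (suc m)) ⟩
  iterate J (J (alternating (suc k))) m 0        ≡⟨ Linear.resp (Linear-iterate m) (J-alternating k) ⟩
  iterate J (S (suc k) 0) m 0                    ≡⟨ iterate-S₀ m k ⟩
  ballot m k                                     ∎

-- The determinant of the rows `S`

e-sym : ∀ p j → e p j ≡ e j p
e-sym zero    zero    = refl
e-sym zero    (suc j) = refl
e-sym (suc p) zero    = refl
e-sym (suc p) (suc j) = e-sym p j

e-shift : ∀ K p j → e (K + p) (K + j) ≡ e p j
e-shift zero    p j = refl
e-shift (suc K) p j = e-shift K p j

reflected-above : ∀ K t → reflected K (K + t) ≡ (λ j → ℤ.- e t j)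
reflected-above zero    t = refl
reflected-above (suc K) t = reflected-above K t

reflected-below : ∀ K t t′ → suc (t + t′) ≡ K → reflected K t ≡ e t′
reflected-below (suc K) zero    t′ refl = refl
reflected-below (suc K) (suc t) t′ eq   = reflected-below K t t′ (ℕ.suc-injective eq)

reflected-off : ∀ K r j → K ≤ j → r < K + j → reflected K r j ≡ 0ℤ
reflected-off zero    r       j K≤j r<      = cong ℤ.-_ (e-off r j (ℕ.<⇒≢ r<))
reflected-off (suc K) zero    j K<j r<      = e-off K j (ℕ.<⇒≢ K<j)
reflected-off (suc K) (suc r) j K<j (s≤s r<) = reflected-off K r j (ℕ.<⇒≤ K<j) r<

skip-above : ∀ j x → j ≤ x → skip j x ≡ suc x
skip-above zero    x       _         = refl
skip-above (suc j) (suc x) (s≤s j≤x) = cong suc (skip-above j x j≤x)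

-- Enumerates the surviving lines when the q lines from index a on have been removed; lines removed
-- at the end only lower the size.
gap : ℕ → ℕ → ℕ → ℕ
gap zero    q i       = q + i
gap (suc a) q zero    = zero
gap (suc a) q (suc i) = suc (gap a q i)

gap-skip : ∀ a q i → gap (suc a) q (skip a i) ≡ gap a (suc q) i
gap-skip zero    q i       = refl
gap-skip (suc a) q zero    = refl
gap-skip (suc a) q (suc i) = cong suc (gap-skip a q i)

gap-below : ∀ a q i → i < a → gap a q i ≡ i
gap-below (suc a) q zero    _         = refl
gap-below (suc a) q (suc i) (s≤s i<a) = cong suc (gap-below a q i i<a)

gap-above : ∀ a q i → a ≤ i → gap a q i ≡ q + i
gap-above zero    q i       _         = refl
gap-above (suc a) q (suc i) (s≤s a≤i) = trans (cong suc (gap-above a q i a≤i)) (sym (ℕ.+-suc q i))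

gap-zero : ∀ a i → gap a 0 i ≡ i
gap-zero zero    i       = refl
gap-zero (suc a) zero    = refl
gap-zero (suc a) (suc i) = cong suc (gap-zero a i)

gap-≤ : ∀ a q i → gap a q i ≤ q + i
gap-≤ zero    q i       = ℕ.≤-refl
gap-≤ (suc a) q zero    = z≤n
gap-≤ (suc a) q (suc i) = subst (suc (gap a q i) ≤_) (sym (ℕ.+-suc q i)) (s≤s (gap-≤ a q i))

e-gap : ∀ a q i → e a (gap (suc a) q i) ≡ e a i
e-gap zero    q zero    = refl
e-gap zero    q (suc i) = refl
e-gap (suc a) q zero    = refl
e-gap (suc a) q (suc i) = e-gap a q i

-- For n = N + 2 K, the last column of S has its only entry 1 in row n - 1 - K and the last
-- row has its only entry -1 in column n - 1 - K.  The two pairs of lines are removed K times,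
-- the remaining ones being those with indices gap (d + N) q i.
Det-S-step : ∀ K N → Det (K * 2 + N) (S K) ≡ Det N (S K)
Det-S-step K N = trans
  (Det-cong (K * 2 + N) (λ i j _ _ → sym (cong₂ (S K) (gap-zero (K + N) i) (gap-zero (K + N) j))))
  (shrink K 0 refl)
  where
  Z : ℕ → ℕ → Rows
  Z d q i j = S K (gap (d + N) q i) (gap (d + N) q j)

  peel : ∀ d q → q + suc d ≡ K → Det (2 + (d * 2 + N)) (Z (suc d) q) ≡ Det (d * 2 + N) (Z d (suc q))
  peel d q q+1+d≡K = begin
    Det (2 + n) (Z (suc d) q)
      ≡⟨ Det-unitColumn (suc n) p 1ℤ (Z (suc d) q) (ℕ.m≤n⇒m≤1+n p≤n) column ⟩
    sgn (suc n) ℤ.* (sgn p ℤ.* (1ℤ ℤ.* Det (suc n) M))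
      ≡⟨ cong (λ z → sgn (suc n) ℤ.* (sgn p ℤ.* (1ℤ ℤ.* z))) (Det-unitRow n p -1ℤ M p≤n row) ⟩
    sgn (suc n) ℤ.* (sgn p ℤ.* (1ℤ ℤ.* (sgn n ℤ.* (sgn p ℤ.* (-1ℤ ℤ.* D)))))
      -- The entry -1 cancels the sign between the sizes n + 2 and n + 1, so the removal is free of
      -- sign.
      ≡⟨ collect (sgn n) (sgn p) D ⟩
    sgn n ℤ.* sgn n ℤ.* (sgn p ℤ.* sgn p) ℤ.* D
      ≡⟨ cong₂ (λ x y → x ℤ.* y ℤ.* D) (sgn-square n) (sgn-square p) ⟩
    1ℤ ℤ.* D
      ≡⟨ ℤ.*-identityˡ D ⟩
    D ≡⟨ Det-cong n (λ i j _ _ → cong₂ (S K) (gap-skip p q i) (gap-skip p q j)) ⟩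
    Det n (Z d (suc q)) ∎
    where
    n = d * 2 + N
    p = d + N

    M : Rows
    M i j = Z (suc d) q (skip p i) j

    D : ℤ
    D = Det n (λ i j → M i (skip p j))

    p≤n : p ≤ n
    p≤n = ℕ.+-monoˡ-≤ N (ℕ.m≤m*n d 2)

    last : gap (suc p) q (suc n) ≡ K + p
    last = trans (gap-above (suc p) q (suc n) (s≤s p≤n))
      (trans (arith q d N) (cong (_+ p) q+1+d≡K))
      where
      arith : ∀ q d N → q + suc (d * 2 + N) ≡ q + suc d + (d + N)
      arith = solveℕ-∀

    inner : ∀ i → i ≤ suc n → gap (suc p) q i ≤ K + p
    inner i i≤ = ℕ.≤-trans (gap-≤ (suc p) q i) (ℕ.≤-trans (ℕ.+-monoʳ-≤ q i≤)
      (ℕ.≤-reflexive (trans (sym (gap-above (suc p) q (suc n) (s≤s p≤n))) last)))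

    0<K : 0 < K
    0<K = subst (0 <_) q+1+d≡K (subst (0 <_) (sym (ℕ.+-suc q d)) z<s)

    column : ∀ i → i ≤ suc n → Z (suc d) q i (suc n) ≡ 1ℤ ℤ.* e p i
    column i i≤ = begin
      S K g (gap (suc p) q (suc n))             ≡⟨ cong (S K g) last ⟩
      e (g + K) (K + p) ℤ.+ reflected K g (K + p)
        -- The entry of `reflected K g` is in column K-1-g or g-K, in both cases left of K+p.
        ≡⟨ cong₂ ℤ._+_ (cong (λ x → e x (K + p)) (ℕ.+-comm g K))
             (reflected-off K g (K + p) (ℕ.m≤m+n K p) (ℕ.≤-<-trans (inner i i≤) (ℕ.+-monoˡ-< (K + p) 0<K))) ⟩
      e (K + g) (K + p) ℤ.+ 0ℤ                  ≡⟨ ℤ.+-identityʳ _ ⟩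
      e (K + g) (K + p)                         ≡⟨ e-shift K g p ⟩
      e g p                                     ≡⟨ trans (e-sym g p) (e-gap p q i) ⟩
      e p i                                     ≡⟨ ℤ.*-identityˡ _ ⟨
      1ℤ ℤ.* e p i                              ∎
      where g = gap (suc p) q i

    row : ∀ j → j ≤ n → M n j ≡ -1ℤ ℤ.* e p j
    row j j≤n = begin
      S K (gap (suc p) q (skip p n)) g          ≡⟨ cong (λ r → S K r g) (trans (cong (gap (suc p) q) (skip-above p n p≤n)) last) ⟩
      e (K + p + K) g ℤ.+ reflected K (K + p) g
        ≡⟨ cong₂ ℤ._+_
             (e-off (K + p + K) g (ℕ.>⇒≢ (ℕ.≤-<-trans (inner j (ℕ.m≤n⇒m≤1+n j≤n)) (ℕ.m<m+n (K + p) 0<K))))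
             (cong (λ u → u g) (reflected-above K p)) ⟩
      0ℤ ℤ.+ (ℤ.- e p g)                        ≡⟨ ℤ.+-identityˡ _ ⟩
      ℤ.- e p g                                 ≡⟨ cong ℤ.-_ (e-gap p q j) ⟩
      ℤ.- e p j                                 ≡⟨ ℤ.-1*i≡-i (e p j) ⟨
      -1ℤ ℤ.* e p j                             ∎
      where g = gap (suc p) q j

    collect : ∀ s t x → ℤ.- s ℤ.* (t ℤ.* (1ℤ ℤ.* (s ℤ.* (t ℤ.* (-1ℤ ℤ.* x))))) ≡ s ℤ.* s ℤ.* (t ℤ.* t) ℤ.* x
    collect = solve-∀

  shrink : ∀ d q → q + d ≡ K → Det (d * 2 + N) (Z d q) ≡ Det N (S K)
  shrink zero    q _  = Det-cong N (λ i j i<N j<N → cong₂ (S K) (gap-below N q i i<N) (gap-below N q j j<N))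
  shrink (suc d) q eq = trans (peel d q eq) (shrink d (suc q) (trans (sym (ℕ.+-suc q d)) eq))

-- The corner is the antidiagonal matrix. Deleting row 0 and the last column leaves the next smaller
-- one, and the signs add up by d + d C 2 = (d+1) C 2.
Det-reflected : ∀ d → Det d (reflected d) ≡ sgn (d C 2)
Det-reflected zero    = Det-zero (reflected 0)
Det-reflected (suc d) = begin
  Det (suc d) (reflected (suc d))                       ≡⟨ Det-unitColumn d 0 1ℤ (reflected (suc d)) z≤n column ⟩
  sgn d ℤ.* (1ℤ ℤ.* (1ℤ ℤ.* Det d (reflected d)))       ≡⟨ cong (sgn d ℤ.*_) (trans (ℤ.*-identityˡ _) (ℤ.*-identityˡ _)) ⟩
  sgn d ℤ.* Det d (reflected d)                         ≡⟨ cong (sgn d ℤ.*_) (Det-reflected d) ⟩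
  sgn d ℤ.* sgn (d C 2)                                 ≡⟨ sgn-+ d (d C 2) ⟨
  sgn (d + d C 2)                                       ≡⟨ cong sgn (cong (_+ d C 2) (nC1≡n d)) ⟨
  sgn (d C 1 + d C 2)                                   ≡⟨ cong sgn (nCk+nC[k+1]≡[n+1]C[k+1] d 1) ⟩
  sgn (suc d C 2)                                       ∎
  where
  column : ∀ i → i ≤ d → reflected (suc d) i d ≡ 1ℤ ℤ.* e 0 i
  column zero    _   = e-diagonal d
  column (suc i) i<d = reflected-off d i d ℕ.≤-refl (ℕ.<-≤-trans i<d (ℕ.m≤m+n d d))

-- Two blocks are removed at a time and their sign is a square, so the sizes 0 and K decide. At size
-- K the summand `e (i + K)` lies outside the corner.
Det-S : ∀ K n₁ → Det (n₁ * K) (S K) ≡ sgn (n₁ * (K C 2))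
Det-S K zero          = Det-zero (S K)
Det-S K (suc zero)    = begin
  Det (K + 0) (S K)   ≡⟨ cong (λ n → Det n (S K)) (ℕ.+-identityʳ K) ⟩
  Det K (S K)         ≡⟨ Det-cong K (λ i j i<K j<K → trans
                           (cong (ℤ._+ reflected K i j) (e-off (i + K) j (ℕ.>⇒≢ (ℕ.<-≤-trans j<K (ℕ.m≤n+m K i)))))
                           (ℤ.+-identityˡ _)) ⟩
  Det K (reflected K) ≡⟨ Det-reflected K ⟩
  sgn (K C 2)         ≡⟨ cong sgn (ℕ.+-identityʳ (K C 2)) ⟨
  sgn (K C 2 + 0)     ∎
Det-S K (suc (suc n₁)) = begin
  Det (K + (K + n₁ * K)) (S K)                ≡⟨ cong (λ n → Det n (S K)) (double K (n₁ * K)) ⟩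
  Det (K * 2 + n₁ * K) (S K)                  ≡⟨ Det-S-step K (n₁ * K) ⟩
  Det (n₁ * K) (S K)                          ≡⟨ Det-S K n₁ ⟩
  sgn (n₁ * c)                                ≡⟨ ℤ.*-identityˡ _ ⟨
  1ℤ ℤ.* sgn (n₁ * c)                         ≡⟨ cong (ℤ._* sgn (n₁ * c)) (sgn-square c) ⟨
  sgn c ℤ.* sgn c ℤ.* sgn (n₁ * c)            ≡⟨ ℤ.*-assoc (sgn c) (sgn c) _ ⟩
  sgn c ℤ.* (sgn c ℤ.* sgn (n₁ * c))          ≡⟨ cong (sgn c ℤ.*_) (sgn-+ c (n₁ * c)) ⟨
  sgn c ℤ.* sgn (c + n₁ * c)                  ≡⟨ sgn-+ c (c + n₁ * c) ⟨
  sgn (c + (c + n₁ * c))                      ∎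
  where
  c = K C 2

  double : ∀ K m → K + (K + m) ≡ K * 2 + m
  double = solveℕ-∀

-- Reflections of the column index and sums over blocks

ins-cong : ∀ p {u v : Vector} R i j → u j ≡ v j → ins p u R i j ≡ ins p v R i j
ins-cong zero    R zero    j eq = eq
ins-cong zero    R (suc i) j eq = refl
ins-cong (suc p) R zero    j eq = refl
ins-cong (suc p) R (suc i) j eq = ins-cong p (R ∘ suc) i j eq

ins-below : ∀ p R i → i ≤ p → ins p (R p) R i ≡ R i
ins-below zero    R zero    _         = refl
ins-below (suc p) R zero    _         = refl
ins-below (suc p) R (suc i) (s≤s i≤p) = ins-below p (R ∘ suc) i i≤p

Det-ins-outside : ∀ n p q R → p < n → n ≤ q → Det n (ins p (e q) R) ≡ 0ℤ
Det-ins-outside n p q R p<n n≤q = trans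
  (Det-cong n (λ i j _ j<n → ins-cong p R i j (e-off q j (ℕ.>⇒≢ (ℕ.<-≤-trans j<n n≤q)))))
  (Linear.kill-zero (Det-ins-linear n p R p<n))

-- A functional that kills enough rows of S is odd under the reflection of the index about
-- every positive multiple of K (the reflection about 0 being built into S).
reflection : ∀ {G} → Linear G → ∀ K q t t′ → suc (t + t′) ≡ K →
  (∀ r → r < q * K + t → G (S K r) ≡ 0ℤ) →
  G (e (suc q * K + t)) ℤ.+ G (e (q * K + t′)) ≡ G (S K (q * K + t))
reflection {G} linear K = go
  where
  open Linear linear

  below : ∀ t t′ → suc (t + t′) ≡ K → G (S K t) ≡ G (e (t + K)) ℤ.+ G (e t′)
  below t t′ eq = trans (add (e (t + K)) (reflected K t))
    (cong (λ u → G (e (t + K)) ℤ.+ G u) (reflected-below K t t′ eq))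

  above : ∀ r → G (S K (K + r)) ≡ G (e (K + r + K)) ℤ.+ (ℤ.- G (e r))
  above r = trans (add (e (K + r + K)) (reflected K (K + r)))
    (cong (λ z → G (e (K + r + K)) ℤ.+ z) (trans (cong G (reflected-above K r)) (neg (e r))))

  lower : ∀ t t′ → suc (t + t′) ≡ K → t < K
  lower t t′ eq = subst (suc t ≤_) eq (s≤s (ℕ.m≤m+n t t′))

  go : ∀ q t t′ → suc (t + t′) ≡ K → (∀ r → r < q * K + t → G (S K r) ≡ 0ℤ) →
    G (e (suc q * K + t)) ℤ.+ G (e (q * K + t′)) ≡ G (S K (q * K + t))
  go zero t t′ eq kills = sym (trans (below t t′ eq) (cong (λ i → G (e i) ℤ.+ G (e t′)) (index t K)))
    where
    index : ∀ t K → t + K ≡ K + 0 + t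
    index = solveℕ-∀
  -- The rows `S K t′` and `S K (K + t)` both contain `e t`, with opposite signs.
  go (suc zero) t t′ eq kills = begin
    G (e (2 * K + t)) ℤ.+ G (e (1 * K + t′))
      ≡⟨ cong₂ (λ i j → G (e i) ℤ.+ G (e j)) (index t K) (index′ t′ K) ⟩
    G (e (K + t + K)) ℤ.+ G (e (t′ + K))
      ≡⟨ cancel (G (e (K + t + K))) (G (e (t′ + K))) (G (e t)) ⟩
    (G (e (t′ + K)) ℤ.+ G (e t)) ℤ.+ (G (e (K + t + K)) ℤ.+ (ℤ.- G (e t)))
      ≡⟨ cong₂ ℤ._+_ (below t′ t eq′) (above t) ⟨
    G (S K t′) ℤ.+ G (S K (K + t))
      ≡⟨ cong (ℤ._+ G (S K (K + t))) (kills t′ (ℕ.<-≤-trans (lower t′ t eq′)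
           (ℕ.≤-trans (ℕ.m≤m+n K 0) (ℕ.m≤m+n (K + 0) t)))) ⟩
    0ℤ ℤ.+ G (S K (K + t))
      ≡⟨ trans (ℤ.+-identityˡ _) (cong (λ i → G (S K (i + t))) (sym (ℕ.+-identityʳ K))) ⟩
    G (S K (1 * K + t)) ∎
    where
    eq′ = trans (cong suc (ℕ.+-comm t′ t)) eq

    index : ∀ t K → 2 * K + t ≡ K + t + K
    index = solveℕ-∀

    index′ : ∀ t K → 1 * K + t ≡ t + K
    index′ = solveℕ-∀

    cancel : ∀ x y z → x ℤ.+ y ≡ (y ℤ.+ z) ℤ.+ (x ℤ.+ (ℤ.- z))
    cancel = solve-∀
  -- The rows S (K+b) and S (K+c) translate the two indices by 2K, which lowers the multiple by two.
  -- Of the rows involved only S (K+b) need not be killed; it is the right-hand side.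
  go (suc (suc q)) t t′ eq kills = begin
    G (e ((3 + q) * K + t)) ℤ.+ G (e ((2 + q) * K + t′))
      ≡⟨ cong₂ (λ i j → G (e i) ℤ.+ G (e j)) (index q t K) (index′ q t′ K) ⟩
    G (e (K + b + K)) ℤ.+ G (e (K + c + K))
      ≡⟨ cancel (G (e (K + b + K))) (G (e (K + c + K))) (G (e b)) (G (e c)) ⟩
    (G (e b) ℤ.+ G (e c)) ℤ.+ (G (e (K + c + K)) ℤ.+ (ℤ.- G (e c))) ℤ.+ (G (e (K + b + K)) ℤ.+ (ℤ.- G (e b)))
      ≡⟨ cong₂ ℤ._+_ (cong₂ ℤ._+_ (go q t t′ eq (λ r r< → kills r (ℕ.<-≤-trans r< small))) (sym (above c))) (sym (above b)) ⟩
    G (S K (q * K + t)) ℤ.+ G (S K (K + c)) ℤ.+ G (S K (K + b))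
      ≡⟨ cong (ℤ._+ G (S K (K + b))) (cong₂ ℤ._+_ (kills (q * K + t) smaller) (kills (K + c) middle)) ⟩
    0ℤ ℤ.+ G (S K (K + b))
      ≡⟨ trans (ℤ.+-identityˡ _) (cong (λ i → G (S K i)) (sym (ℕ.+-assoc K (suc q * K) t))) ⟩
    G (S K ((2 + q) * K + t)) ∎
    where
    b = suc q * K + t
    c = q * K + t′

    index : ∀ q t K → (3 + q) * K + t ≡ K + (suc q * K + t) + K
    index = solveℕ-∀

    index′ : ∀ q t K → (2 + q) * K + t ≡ K + (q * K + t) + K
    index′ = solveℕ-∀

    small : q * K + t ≤ (2 + q) * K + t
    small = ℕ.+-monoˡ-≤ t (ℕ.*-monoˡ-≤ K (ℕ.m≤n+m q 2))

    middle : K + c < (2 + q) * K + t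
    middle = subst (_< (2 + q) * K + t) (ℕ.+-assoc K (q * K) t′)
      (ℕ.<-≤-trans (ℕ.+-monoʳ-< (suc q * K) (lower t′ t (trans (cong suc (ℕ.+-comm t′ t)) eq)))
        (ℕ.≤-trans (ℕ.≤-reflexive (ℕ.+-comm (suc q * K) K)) (ℕ.m≤m+n _ t)))

    smaller : q * K + t < (2 + q) * K + t
    smaller = ℕ.+-monoˡ-< t (ℕ.<-≤-trans (ℕ.m<n+m (q * K) (ℕ.≤-<-trans z≤n (lower t t′ eq)))
      (ℕ.*-monoˡ-≤ K (ℕ.n≤1+n (suc q))))

    cancel : ∀ x y z w → x ℤ.+ y ≡ (z ℤ.+ w) ℤ.+ (y ℤ.+ (ℤ.- w)) ℤ.+ (x ℤ.+ (ℤ.- z))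
    cancel = solve-∀

alternating-below : ∀ K j → j < K → alternating K j ≡ 0ℤ
alternating-below (suc K) zero    _         = refl
alternating-below (suc K) (suc j) (s≤s j<K) = alternating-below K j j<K

alternating-above : ∀ K j → alternating K (K + j) ≡ sgn j
alternating-above zero    j = refl
alternating-above (suc K) j = alternating-above K j

∑-blocks : ∀ K m (f : ℕ → ℤ) b → (∀ p → p < m → ∑ K (λ t → f (p * K + t)) ≡ b) → ∑ (m * K) f ≡ + m ℤ.* b
∑-blocks K zero    f b blocks = ∑-zero 0 (λ _ ())
∑-blocks K (suc m) f b blocks = begin
  ∑ (K + m * K) f                            ≡⟨ cong (λ n → ∑ n f) (ℕ.+-comm K (m * K)) ⟩
  ∑ (m * K + K) f                            ≡⟨ ∑-split (m * K) K f ⟩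
  ∑ (m * K) f ℤ.+ ∑ K (λ t → f (m * K + t))
    ≡⟨ cong₂ ℤ._+_ (∑-blocks K m f b (λ p p<m → blocks p (ℕ.m<n⇒m<1+n p<m))) (blocks m ℕ.≤-refl) ⟩
  + m ℤ.* b ℤ.+ b                            ≡⟨ ℤ.+-comm _ b ⟩
  b ℤ.+ + m ℤ.* b                            ≡⟨ ℤ.suc-* (+ m) b ⟨
  + suc m ℤ.* b                              ∎

-- Reflecting a block turns it into the previous one, so all blocks contribute the same as
-- the last one, where only the first summand survives.
∑-alternating : ∀ k m (h : ℕ → ℤ) → let K = suc k in
  (∀ p t t′ → suc (t + t′) ≡ K → suc p < m → h ((2 + p) * K + t) ≡ ℤ.- h (suc p * K + t′)) →
  (∀ t → t < k → h (m * K + suc t) ≡ 0ℤ) →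
  ∑ (suc m * K) (λ j → alternating K j ℤ.* h j) ≡ + m ℤ.* (sgn K ℤ.* (sgn (m * K) ℤ.* h (m * K)))
∑-alternating k m h odd-h zero-h = begin
  ∑ (K + m * K) (λ j → alternating K j ℤ.* h j)
    ≡⟨ ∑-split K (m * K) _ ⟩
  ∑ K (λ j → alternating K j ℤ.* h j) ℤ.+ ∑ (m * K) (λ j → alternating K (K + j) ℤ.* h (K + j))
    ≡⟨ cong₂ ℤ._+_
         (∑-zero K (λ j j<K → trans (cong (ℤ._* h j) (alternating-below K j j<K)) (ℤ.*-zeroˡ (h j))))
         (∑-cong (m * K) (λ j _ → cong (ℤ._* h (K + j)) (alternating-above K j))) ⟩
  0ℤ ℤ.+ ∑ (m * K) f
    ≡⟨ ℤ.+-identityˡ _ ⟩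
  ∑ (m * K) f
    ≡⟨ ∑-blocks K m f b (λ p p<m → block p (m ∸ suc p) (trans (ℕ.+-suc p _) (ℕ.m+[n∸m]≡n p<m))) ⟩
  + m ℤ.* b ∎
  where
  K = suc k

  f : ℕ → ℤ
  f j = sgn j ℤ.* h (K + j)

  b : ℤ
  b = sgn K ℤ.* (sgn (m * K) ℤ.* h (m * K))

  reflect : ∀ p t t′ → suc (t + t′) ≡ K → suc p < m → f (suc p * K + t) ≡ f (p * K + t′)
  reflect p t t′ eq 1+p<m = begin
    sgn (K + p * K + t) ℤ.* h (K + (suc p * K + t))
      ≡⟨ cong₂ ℤ._*_ sign (trans (cong h (sym (ℕ.+-assoc K (suc p * K) t))) (odd-h p t t′ eq 1+p<m)) ⟩
    ℤ.- sgn (p * K + t′) ℤ.* (ℤ.- h (K + p * K + t′))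
      ≡⟨ neg*neg (sgn (p * K + t′)) _ ⟩
    sgn (p * K + t′) ℤ.* h (K + p * K + t′)
      ≡⟨ cong (λ i → sgn (p * K + t′) ℤ.* h i) (ℕ.+-assoc K (p * K) t′) ⟩
    f (p * K + t′) ∎
    where
    neg*neg : ∀ x y → ℤ.- x ℤ.* (ℤ.- y) ≡ x ℤ.* y
    neg*neg = solve-∀

    index : ∀ t t′ x → suc (t + t′) + x + t ≡ suc (t + t + (x + t′))
    index = solveℕ-∀

    sign : sgn (K + p * K + t) ≡ ℤ.- sgn (p * K + t′)
    sign = begin
      sgn (K + p * K + t)                            ≡⟨ cong (λ i → sgn (i + p * K + t)) eq ⟨
      sgn (suc (t + t′) + p * K + t)                 ≡⟨ cong sgn (index t t′ (p * K)) ⟩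
      ℤ.- sgn (t + t + (p * K + t′))                 ≡⟨ cong ℤ.-_ (sgn-+ (t + t) (p * K + t′)) ⟩
      ℤ.- (sgn (t + t) ℤ.* sgn (p * K + t′))         ≡⟨ cong (λ x → ℤ.- (x ℤ.* sgn (p * K + t′))) (trans (sgn-+ t t) (sgn-square t)) ⟩
      ℤ.- (1ℤ ℤ.* sgn (p * K + t′))                  ≡⟨ cong ℤ.-_ (ℤ.*-identityˡ _) ⟩
      ℤ.- sgn (p * K + t′)                           ∎

  block : ∀ p d → p + suc d ≡ m → ∑ K (λ t → f (p * K + t)) ≡ b
  block p zero p+1≡m = begin
    ∑ K (λ t → f (p * K + t))
      ≡⟨ ∑-suc k _ ⟩
    f (p * K + 0) ℤ.+ ∑ k (λ t → f (p * K + suc t))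
      ≡⟨ cong₂ ℤ._+_ (cong f (ℕ.+-identityʳ (p * K))) (∑-zero k (λ t t<k → trans
           (cong (sgn (p * K + suc t) ℤ.*_) (trans
             (cong h (trans (sym (ℕ.+-assoc K (p * K) (suc t))) (cong (λ i → i * K + suc t) 1+p≡m))) (zero-h t t<k)))
           (ℤ.*-zeroʳ (sgn (p * K + suc t))))) ⟩
    f (p * K) ℤ.+ 0ℤ
      ≡⟨ ℤ.+-identityʳ _ ⟩
    sgn (p * K) ℤ.* h (K + p * K)
      ≡⟨ cong (λ x → x ℤ.* h (K + p * K)) (ℤ.*-identityˡ (sgn (p * K))) ⟨
    1ℤ ℤ.* sgn (p * K) ℤ.* h (K + p * K)
      ≡⟨ cong (λ x → x ℤ.* sgn (p * K) ℤ.* h (K + p * K)) (sgn-square K) ⟨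
    sgn K ℤ.* sgn K ℤ.* sgn (p * K) ℤ.* h (K + p * K)
      ≡⟨ assoc (sgn K) (sgn (p * K)) (h (K + p * K)) ⟩
    sgn K ℤ.* (sgn K ℤ.* sgn (p * K) ℤ.* h (K + p * K))
      ≡⟨ cong (λ x → sgn K ℤ.* (x ℤ.* h (K + p * K))) (sgn-+ K (p * K)) ⟨
    sgn K ℤ.* (sgn (suc p * K) ℤ.* h (suc p * K))
      ≡⟨ cong (λ i → sgn K ℤ.* (sgn (i * K) ℤ.* h (i * K))) 1+p≡m ⟩
    b ∎
    where
    1+p≡m = trans (ℕ.+-comm 1 p) p+1≡m

    assoc : ∀ x y z → x ℤ.* x ℤ.* y ℤ.* z ≡ x ℤ.* (x ℤ.* y ℤ.* z)
    assoc = solve-∀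
  block p (suc d) eq = trans
    (∑-reverse K _ _ (λ t t′ t+t′ → sym (reflect p t′ t (trans (cong suc (ℕ.+-comm t′ t)) t+t′) 1+p<m)))
    (block (suc p) d (trans (sym (ℕ.+-suc p (suc d))) eq))
    where
    1+p<m : suc p < m
    1+p<m = subst (suc p <_) eq (subst (_< p + (2 + d)) (ℕ.+-comm p 1) (ℕ.+-monoʳ-< p (s≤s z<s)))

-- The determinant as a function of its first row

module FirstRow (k N : ℕ) where
  K n : ℕ
  K = suc k
  n = suc N

  G : Vector → ℤ
  G u = Det n (ins 0 u (S K))

  h : ℕ → ℤ
  h j = G (e j)

  G-linear : Linear G
  G-linear = Det-ins-linear n 0 (S K) z<s

  kills : ∀ r → r < N → G (S K r) ≡ 0ℤ
  kills r r<N = Det-ins-repeat n 0 r (S K) z<s (s<s r<N)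

  -- Moved from the top to the bottom, past N rows, `S K N` completes the sequence of rows S 0, ...,
  -- S N.
  G-S : G (S K N) ≡ sgn N ℤ.* Det n (S K)
  G-S = begin
    G (S K N)                                     ≡⟨ ℤ.*-identityˡ _ ⟨
    1ℤ ℤ.* G (S K N)                              ≡⟨ cong (ℤ._* G (S K N)) (sgn-square N) ⟨
    sgn N ℤ.* sgn N ℤ.* G (S K N)                 ≡⟨ ℤ.*-assoc (sgn N) (sgn N) _ ⟩
    sgn N ℤ.* (sgn N ℤ.* G (S K N))               ≡⟨ cong (sgn N ℤ.*_) (Det-ins n N (S K N) (S K) ℕ.≤-refl) ⟨
    sgn N ℤ.* Det n (ins N (S K N) (S K))
      ≡⟨ cong (sgn N ℤ.*_) (Det-cong n (λ i j i<n _ → cong (λ u → u j) (ins-below N (S K) i (ℕ.≤-pred i<n)))) ⟩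
    sgn N ℤ.* Det n (S K)                         ∎

  h-minor : ∀ j → j < n → h j ≡ sgn j ℤ.* Det N (λ i l → S K i (skip j l))
  h-minor j j<n = trans (Det-suc N (ins 0 (e j) (S K))) (trans
    (∑-cong n (λ i _ → rearrange (sgn i) (e j i) _))
    (∑-pick n j (λ i → sgn i ℤ.* Det N (λ r l → S K r (skip i l))) j<n))
    where
    rearrange : ∀ s x d → s ℤ.* (x ℤ.* d) ≡ s ℤ.* d ℤ.* x
    rearrange = solve-∀

  h-N : h N ≡ sgn N ℤ.* Det N (S K)
  h-N = trans (h-minor N ℕ.≤-refl) (cong (sgn N ℤ.*_)
    (Det-cong N (λ i j _ j<N → cong (S K i) (skip-below N j j<N))))

  h-outside : ∀ j → n ≤ j → h j ≡ 0ℤ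
  h-outside j n≤j = Det-ins-outside n 0 j (S K) z<s n≤j

  G-∑ : ∀ u → G u ≡ ∑ n (λ j → u j ℤ.* h j)
  G-∑ u = trans (Det-suc N (ins 0 u (S K))) (∑-cong n (λ j j<n →
    trans (rearrange (sgn j) (u j) _) (cong (u j ℤ.*_) (sym (h-minor j j<n)))))
    where
    rearrange : ∀ s x d → s ℤ.* (x ℤ.* d) ≡ x ℤ.* (s ℤ.* d)
    rearrange = solve-∀

  -- This is the reflection about (p+2) K; p+1 < m keeps all rows it uses among the killed ones.
  h-odd : ∀ m → m * K ≤ N → ∀ p t t′ → suc (t + t′) ≡ K → suc p < m → h ((2 + p) * K + t) ≡ ℤ.- h (suc p * K + t′)
  h-odd m mK≤N p t t′ eq 1+p<m = trans (solve-for (h ((2 + p) * K + t)) (h (suc p * K + t′)))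
    (trans (cong (λ z → z ℤ.- h (suc p * K + t′)) (trans
      (reflection G-linear K (suc p) t t′ eq (λ r r< → kills r (ℕ.<-trans r< inside)))
      (kills (suc p * K + t) inside))) (ℤ.+-identityˡ _))
    where
    solve-for : ∀ x y → x ≡ x ℤ.+ y ℤ.- y
    solve-for = solve-∀

    inside : suc p * K + t < N
    inside = ℕ.<-≤-trans (ℕ.+-monoʳ-< (suc p * K) (subst (suc t ≤_) eq (s≤s (ℕ.m≤m+n t t′))))
      (ℕ.≤-trans (ℕ.≤-reflexive (ℕ.+-comm (suc p * K) K)) (ℕ.≤-trans (ℕ.*-monoˡ-≤ K 1+p<m) mK≤N))

Det-T-multiple : ∀ k m → let K = suc k in
  Det (suc m * K) (T K) ≡ ℤ.- (+ m ℤ.* Det (suc m * K) (S K))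
Det-T-multiple k m = begin
  G (alternating K)                                         ≡⟨ G-∑ (alternating K) ⟩
  ∑ n (λ j → alternating K j ℤ.* h j)                       ≡⟨ ∑-alternating k m h (h-odd m (ℕ.m≤n+m (m * K) k)) vanish ⟩
  + m ℤ.* (sgn K ℤ.* (sgn (m * K) ℤ.* h (m * K)))           ≡⟨ cong (λ x → + m ℤ.* (sgn K ℤ.* (sgn (m * K) ℤ.* x))) first ⟩
  + m ℤ.* (sgn K ℤ.* (sgn (m * K) ℤ.* (sgn N ℤ.* E)))       ≡⟨ cong (λ x → + m ℤ.* (sgn K ℤ.* (sgn (m * K) ℤ.* (x ℤ.* E)))) (sgn-+ k (m * K)) ⟩
  + m ℤ.* (ℤ.- sgn k ℤ.* (sgn (m * K) ℤ.* (sgn k ℤ.* sgn (m * K) ℤ.* E)))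
    ≡⟨ collect (+ m) (sgn k) (sgn (m * K)) E ⟩
  ℤ.- (sgn k ℤ.* sgn k ℤ.* (sgn (m * K) ℤ.* sgn (m * K)) ℤ.* (+ m ℤ.* E))
    ≡⟨ cong₂ (λ x y → ℤ.- (x ℤ.* y ℤ.* (+ m ℤ.* E))) (sgn-square k) (sgn-square (m * K)) ⟩
  ℤ.- (1ℤ ℤ.* (+ m ℤ.* E))                                  ≡⟨ cong ℤ.-_ (ℤ.*-identityˡ _) ⟩
  ℤ.- (+ m ℤ.* E)                                           ∎
  where
  open FirstRow k (k + m * suc k)
  N = k + m * K

  E : ℤ
  E = Det n (S K)

  collect : ∀ x s t d → x ℤ.* (ℤ.- s ℤ.* (t ℤ.* (s ℤ.* t ℤ.* d))) ≡ ℤ.- (s ℤ.* s ℤ.* (t ℤ.* t) ℤ.* (x ℤ.* d))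
  collect = solve-∀

  -- The reflection about n = (m+1) K pairs the last block with columns outside the matrix. The row
  -- S (mK+s) is killed unless s = k, that is t = 0, where it is `S K N` and yields the full
  -- determinant of S.
  last-block : ∀ s t → s + t ≡ k → h (m * K + t) ≡ G (S K (m * K + s))
  last-block s t s+t≡k = begin
    h (m * K + t)                               ≡⟨ ℤ.+-identityˡ _ ⟨
    0ℤ ℤ.+ h (m * K + t)                        ≡⟨ cong (ℤ._+ h (m * K + t)) (h-outside (suc m * K + s) (ℕ.m≤m+n (suc m * K) s)) ⟨
    h (suc m * K + s) ℤ.+ h (m * K + t)         ≡⟨ reflection G-linear K m s t (cong suc s+t≡k) (λ r r< →
                                                     kills r (ℕ.<-≤-trans r< (ℕ.≤-trans (ℕ.+-monoʳ-≤ (m * K) (subst (s ≤_) s+t≡k (ℕ.m≤m+n s t)))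
                                                       (ℕ.≤-reflexive (ℕ.+-comm (m * K) k))))) ⟩
    G (S K (m * K + s))                         ∎

  vanish : ∀ t → t < k → h (m * K + suc t) ≡ 0ℤ
  vanish t t<k = trans (last-block (k ∸ suc t) (suc t) (ℕ.m∸n+n≡m t<k))
    (kills (m * K + (k ∸ suc t)) (subst (m * K + (k ∸ suc t) <_) (ℕ.+-comm (m * K) k)
      (ℕ.+-monoʳ-< (m * K) (ℕ.∸-monoʳ-< z<s t<k))))

  first : h (m * K) ≡ sgn N ℤ.* E
  first = trans (cong h (sym (ℕ.+-identityʳ (m * K))))
    (trans (last-block k 0 (ℕ.+-identityʳ k)) (trans (cong (λ r → G (S K r)) (ℕ.+-comm (m * K) k)) G-S))

-- Only the first column of the last block lies in the matrix, and its minor is the corner of S of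
-- size m K.
Det-T-multiple+1 : ∀ k m → let K = suc k in
  Det (suc (m * K)) (T K) ≡ + m ℤ.* (sgn K ℤ.* Det (m * K) (S K))
Det-T-multiple+1 k m = begin
  G (alternating K)                                         ≡⟨ G-∑ (alternating K) ⟩
  -- The last block is padded with columns outside the matrix, where h vanishes.
  ∑ n f                                                     ≡⟨ ℤ.+-identityʳ _ ⟨
  ∑ n f ℤ.+ 0ℤ                                              ≡⟨ cong (λ z → ∑ n f ℤ.+ z) (∑-zero k tail) ⟨
  ∑ n f ℤ.+ ∑ k (λ t → f (n + t))                           ≡⟨ ∑-split n k f ⟨
  ∑ (n + k) f                                               ≡⟨ cong (λ i → ∑ (suc i) f) (ℕ.+-comm (m * K) k) ⟩
  ∑ (suc m * K) f                                           ≡⟨ ∑-alternating k m h (h-odd m ℕ.≤-refl) vanish ⟩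
  + m ℤ.* (sgn K ℤ.* (sgn N ℤ.* h N))                       ≡⟨ cong (λ x → + m ℤ.* (sgn K ℤ.* (sgn N ℤ.* x))) h-N ⟩
  + m ℤ.* (sgn K ℤ.* (sgn N ℤ.* (sgn N ℤ.* E)))             ≡⟨ cong (λ x → + m ℤ.* (sgn K ℤ.* x)) (ℤ.*-assoc (sgn N) (sgn N) E) ⟨
  + m ℤ.* (sgn K ℤ.* (sgn N ℤ.* sgn N ℤ.* E))               ≡⟨ cong (λ x → + m ℤ.* (sgn K ℤ.* (x ℤ.* E))) (sgn-square N) ⟩
  + m ℤ.* (sgn K ℤ.* (1ℤ ℤ.* E))                            ≡⟨ cong (λ x → + m ℤ.* (sgn K ℤ.* x)) (ℤ.*-identityˡ E) ⟩
  + m ℤ.* (sgn K ℤ.* E)                                     ∎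
  where
  open FirstRow k (m * suc k)
  N = m * K

  E : ℤ
  E = Det N (S K)

  f : ℕ → ℤ
  f j = alternating K j ℤ.* h j

  tail : ∀ t → t < k → f (n + t) ≡ 0ℤ
  tail t _ = trans (cong (alternating K (n + t) ℤ.*_) (h-outside (n + t) (ℕ.m≤m+n n t)))
    (ℤ.*-zeroʳ (alternating K (n + t)))

  vanish : ∀ t → t < k → h (m * K + suc t) ≡ 0ℤ
  vanish t _ = h-outside (m * K + suc t) (ℕ.≤-trans (ℕ.≤-reflexive (ℕ.+-comm 1 N)) (ℕ.+-monoʳ-≤ N (s≤s z≤n)))

-- Modulo the rows S r with r < q K, the row S (q K) is e ((q + 1) K) + e ((q + 1) K - 1),
-- which has no entry in the first q K + s columns.
Det-T-otherwise : ∀ k q s → 2 ≤ s → s ≤ k → Det (q * suc k + s) (T (suc k)) ≡ 0ℤ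
Det-T-otherwise k q s 2≤s s≤k = begin
  Det n (T K)                            ≡⟨ Det-cong n (λ i j _ _ → cong (λ u → u j) (ins-skip p (T K) i)) ⟩
  G (S K (q * K))                        ≡⟨ cong (λ r → G (S K r)) (ℕ.+-identityʳ (q * K)) ⟨
  G (S K (q * K + 0))                    ≡⟨ reflection linear K q 0 k refl kills ⟨
  G (e (suc q * K + 0)) ℤ.+ G (e (q * K + k))
    ≡⟨ cong₂ ℤ._+_ (Det-ins-outside n p _ R p<n (ℕ.≤-trans n≤ (ℕ.≤-trans (ℕ.≤-reflexive (ℕ.+-comm (q * K) k))
         (ℕ.≤-trans (ℕ.n≤1+n _) (ℕ.m≤m+n (suc q * K) 0)))))
         (Det-ins-outside n p _ R p<n n≤) ⟩
  0ℤ                                     ∎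
  where
  K = suc k
  n = q * K + s
  -- The row S (q K) of T comes one later because of the row in front; 2 ≤ s places it inside the
  -- matrix.
  p = suc (q * K)

  R : Rows
  R = T K ∘ skip p

  G : Vector → ℤ
  G u = Det n (ins p u R)

  n≤ : n ≤ q * K + k
  n≤ = ℕ.+-monoʳ-≤ (q * K) s≤k

  p<n : p < n
  p<n = ℕ.≤-trans (ℕ.≤-reflexive (ℕ.+-comm 2 (q * K))) (ℕ.+-monoʳ-≤ (q * K) 2≤s)

  linear : Linear G
  linear = Det-ins-linear n p R p<n

  kills : ∀ r → r < q * K + 0 → G (S K r) ≡ 0ℤ
  kills r r< = subst (λ u → G u ≡ 0ℤ) (cong (T K) (skip-below p (suc r) (s<s r<qK)))
    (Det-ins-repeat n p (suc r) R p<n (ℕ.≤-<-trans (s≤s r<qK) p<n))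
    where
    r<qK : r < q * K
    r<qK = subst (r <_) (ℕ.+-identityʳ (q * K)) r<

-- From rational to integer determinants

/-* : ∀ x b y z → x ℤ.* y ≡ z ℤ.* + suc b → (x / suc b) ℚ.* (y / 1) ≡ z / 1
/-* x b y z eq = ℚ.toℚᵘ-injective (ℚᵘ.≃-trans (ℚ.toℚᵘ-homo-* (x / suc b) (y / 1)) (ℚᵘ.≃-trans
  (ℚᵘ.*-cong (ℚ.toℚᵘ-fromℚᵘ (ℚᵘ.mkℚᵘ x b)) (ℚ.toℚᵘ-fromℚᵘ (ℚᵘ.mkℚᵘ y 0)))
  (ℚᵘ.≃-trans
    (ℚᵘ.*≡* (trans (ℤ.*-identityʳ (x ℤ.* y)) (trans eq (cong (λ d → z ℤ.* + d) (sym (ℕ.*-identityʳ (suc b)))))))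
    (ℚᵘ.≃-sym (ℚ.toℚᵘ-fromℚᵘ (ℚᵘ.mkℚᵘ z 0))))))

/1-* : ∀ x y → (x / 1) ℚ.* (y / 1) ≡ (x ℤ.* y) / 1
/1-* x y = /-* x 0 y (x ℤ.* y) (sym (ℤ.*-identityʳ (x ℤ.* y)))

/1-+ : ∀ x y → (x / 1) ℚ.+ (y / 1) ≡ (x ℤ.+ y) / 1
/1-+ x y = ℚ.toℚᵘ-injective (ℚᵘ.≃-trans (ℚ.toℚᵘ-homo-+ (x / 1) (y / 1)) (ℚᵘ.≃-trans
  (ℚᵘ.+-cong (ℚ.toℚᵘ-fromℚᵘ (ℚᵘ.mkℚᵘ x 0)) (ℚ.toℚᵘ-fromℚᵘ (ℚᵘ.mkℚᵘ y 0)))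
  (ℚᵘ.≃-trans
    (ℚᵘ.*≡* (cong (ℤ._* 1ℤ) (cong₂ ℤ._+_ (ℤ.*-identityʳ x) (ℤ.*-identityʳ y))))
    (ℚᵘ.≃-sym (ℚ.toℚᵘ-fromℚᵘ (ℚᵘ.mkℚᵘ (x ℤ.+ y) 0))))))

sgn-/1 : ∀ n → (ℚ.- ℚ.1ℚ) ^ℚ n ≡ sgn n / 1
sgn-/1 zero    = refl
sgn-/1 (suc n) = trans (cong ((ℚ.- ℚ.1ℚ) ℚ.*_) (sgn-/1 n))
  (trans (/1-* -1ℤ (sgn n)) (cong (_/ 1) (ℤ.-1*i≡-i (sgn n))))

sum-/1 : ∀ n {f : Fin n → ℚ} {g : ℕ → ℤ} → (∀ j → f j ≡ g (toℕ j) / 1) → sum f ≡ ∑ n g / 1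
sum-/1 zero    eq = cong (_/ 1) (sym (∑-zero 0 (λ _ ())))
sum-/1 (suc n) {g = g} eq = trans (cong₂ ℚ._+_ (eq zero) (sum-/1 n (λ j → eq (suc j))))
  (trans (/1-+ (g 0) (∑ n (g ∘ suc))) (cong (_/ 1) (sym (∑-suc n g))))

toℕ-punchIn : ∀ {n} (j : Fin (suc n)) (l : Fin n) → toℕ (punchIn j l) ≡ skip (toℕ j) (toℕ l)
toℕ-punchIn zero    l       = refl
toℕ-punchIn (suc j) zero    = refl
toℕ-punchIn (suc j) (suc l) = cong suc (toℕ-punchIn j l)

det-/1 : ∀ n {M : Fin n → Fin n → ℚ} {N : Rows} → (∀ i j → M i j ≡ N (toℕ i) (toℕ j) / 1) → det M ≡ Det n N / 1
det-/1 zero    {N = N} eq = cong (_/ 1) (sym (Det-zero N))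
det-/1 (suc n) {M} {N} eq = trans
  (sum-/1 (suc n) {g = λ j → sgn j ℤ.* (N 0 j ℤ.* D j)} (λ j → begin
    (ℚ.- ℚ.1ℚ) ^ℚ toℕ j ℚ.* (M zero j ℚ.* det (λ i l → M (suc i) (punchIn j l)))
      ≡⟨ cong₂ ℚ._*_ (sgn-/1 (toℕ j)) (cong₂ ℚ._*_ (eq zero j) (det-/1 n {N = minor (toℕ j)} (λ i l →
           trans (eq (suc i) (punchIn j l)) (cong (λ x → N (suc (toℕ i)) x / 1) (toℕ-punchIn j l))))) ⟩
    (sgn (toℕ j) / 1) ℚ.* ((N 0 (toℕ j) / 1) ℚ.* (D (toℕ j) / 1))
      ≡⟨ cong ((sgn (toℕ j) / 1) ℚ.*_) (/1-* (N 0 (toℕ j)) (D (toℕ j))) ⟩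
    (sgn (toℕ j) / 1) ℚ.* ((N 0 (toℕ j) ℤ.* D (toℕ j)) / 1)
      ≡⟨ /1-* (sgn (toℕ j)) (N 0 (toℕ j) ℤ.* D (toℕ j)) ⟩
    (sgn (toℕ j) ℤ.* (N 0 (toℕ j) ℤ.* D (toℕ j))) / 1 ∎))
  (cong (_/ 1) (sym (Det-suc n N)))
  where
  minor : ℕ → Rows
  minor j i l = N (suc i) (skip j l)

  D : ℕ → ℤ
  D j = Det n (minor j)

-- The identity (b+1) C(a,b+1) = (a-b) C(a,b) without subtraction, hence valid also for b > a.
absorption : ∀ a b → suc b * (a C suc b) + b * (a C b) ≡ a * (a C b)
absorption zero    zero    = refl
absorption zero    (suc b) = cong₂ _+_
  (trans (cong (suc (suc b) *_) (k>n⇒nCk≡0 {0} {2 + b} z<s)) (ℕ.*-zeroʳ (suc (suc b))))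
  (trans (cong (suc b *_) (k>n⇒nCk≡0 {0} {suc b} z<s)) (ℕ.*-zeroʳ (suc b)))
absorption (suc a) zero    = trans (ℕ.+-identityʳ _) (trans (ℕ.+-identityʳ _)
  (trans (nC1≡n (suc a)) (sym (ℕ.*-identityʳ (suc a)))))
absorption (suc a) (suc b) = begin
  (2 + b) * (suc a C (2 + b)) + suc b * (suc a C suc b)
    ≡⟨ cong₂ (λ u v → (2 + b) * u + suc b * v) (pascal (suc b)) (pascal b) ⟨
  (2 + b) * (y + z) + suc b * (x + y)
    ≡⟨ regroup b x y z ⟩
  ((2 + b) * z + suc b * y) + (suc b * y + b * x) + (x + y)
    ≡⟨ cong (_+ (x + y)) (cong₂ _+_ (absorption a (suc b)) (absorption a b)) ⟩
  a * y + a * x + (x + y)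
    ≡⟨ collect a x y ⟩
  suc a * (x + y)
    ≡⟨ cong (suc a *_) (pascal b) ⟩
  suc a * (suc a C suc b) ∎
  where
  pascal = nCk+nC[k+1]≡[n+1]C[k+1] a
  x = a C b
  y = a C suc b
  z = a C (2 + b)

  regroup : ∀ b x y z → (2 + b) * (y + z) + suc b * (x + y) ≡ ((2 + b) * z + suc b * y) + (suc b * y + b * x) + (x + y)
  regroup = solveℕ-∀

  collect : ∀ a x y → a * y + a * x + (x + y) ≡ suc a * (x + y)
  collect = solveℕ-∀

-- This makes the quotient in the matrix entry an integer. With d = m+k+2, absorption gives d y =
-- (2m+1) x - (m+k+1) x, which is d x - (2k+2) x.
ballot-fraction : ∀ m k → + (2 * k + 2) ℤ.* + (odd m C suc (m + k)) ≡ ballot m k ℤ.* + suc (suc m + k)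
ballot-fraction m k = begin
  + (2 * k + 2) ℤ.* + x                              ≡⟨ solve-for (+ (2 * k + 2) ℤ.* + x) (+ d ℤ.* + y) ⟩
  + (2 * k + 2) ℤ.* + x ℤ.+ + d ℤ.* + y ℤ.- + d ℤ.* + y
    ≡⟨ cong (ℤ._- + d ℤ.* + y) (cong₂ ℤ._+_ (ℤ.pos-* (2 * k + 2) x) (ℤ.pos-* d y)) ⟨
  + ((2 * k + 2) * x + d * y) ℤ.- + d ℤ.* + y        ≡⟨ cong (λ w → + w ℤ.- + d ℤ.* + y) natural ⟩
  + (d * x) ℤ.- + d ℤ.* + y                          ≡⟨ cong (ℤ._- + d ℤ.* + y) (ℤ.pos-* d x) ⟩
  + d ℤ.* + x ℤ.- + d ℤ.* + y                        ≡⟨ factor (+ d) (+ x) (+ y) ⟩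
  (+ x ℤ.- + y) ℤ.* + d                              ∎
  where
  d = suc (suc m + k)
  x = odd m C suc (m + k)
  y = odd m C (2 + (m + k))

  solve-for : ∀ u v → u ≡ u ℤ.+ v ℤ.- v
  solve-for = solve-∀

  factor : ∀ d x y → d ℤ.* x ℤ.- d ℤ.* y ≡ (x ℤ.- y) ℤ.* d
  factor = solve-∀

  count : ∀ m k x → (2 * k + 2) * x + (m + suc m) * x ≡ suc (suc m + k) * x + suc (m + k) * x
  count = solveℕ-∀

  natural : (2 * k + 2) * x + d * y ≡ d * x
  natural = ℕ.+-cancelʳ-≡ (suc (m + k) * x) _ _ (begin
    (2 * k + 2) * x + d * y + suc (m + k) * x      ≡⟨ ℕ.+-assoc ((2 * k + 2) * x) (d * y) _ ⟩
    (2 * k + 2) * x + (d * y + suc (m + k) * x)    ≡⟨ cong (λ w → (2 * k + 2) * x + w) (absorption (odd m) (suc (m + k))) ⟩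
    (2 * k + 2) * x + odd m * x                    ≡⟨ cong (λ o → (2 * k + 2) * x + o * x) (odd≡ m) ⟩
    (2 * k + 2) * x + (m + suc m) * x              ≡⟨ count m k x ⟩
    d * x + suc (m + k) * x                        ∎)

odd-top : ∀ i j m → i + j ≡ suc m → 2 * i + 2 * j ∸ 1 ≡ odd m
odd-top i j m i+j≡1+m = begin
  2 * i + 2 * j ∸ 1    ≡⟨ cong (_∸ 1) (ℕ.*-distribˡ-+ 2 i j) ⟨
  2 * (i + j) ∸ 1      ≡⟨ cong (λ s → 2 * s ∸ 1) i+j≡1+m ⟩
  2 * suc m ∸ 1        ≡⟨ cong (_∸ 1) (double m) ⟩
  m + suc m            ≡⟨ odd≡ m ⟨
  odd m                ∎
  where
  double : ∀ m → 2 * suc m ≡ suc (m + suc m)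
  double = solveℕ-∀

entry-ballot : ∀ k i j m → i + j ≡ suc m →
  (+ (2 * k + 2) / suc (i + j + k)) ℚ.* (+ ((2 * i + 2 * j ∸ 1) C (i + j + k)) / 1) ≡ X (suc k) (i + j) 0 / 1
entry-ballot k i j m i+j≡1+m rewrite odd-top i j m i+j≡1+m | i+j≡1+m = trans
  (/-* (+ (2 * k + 2)) (suc m + k) (+ (odd m C suc (m + k))) (ballot m k) (ballot-fraction m k))
  (cong (_/ 1) (sym (X-ballot m k)))

entry≡moment : ∀ k i j → entry k i j ≡ X (suc k) (i + j) 0 / 1
-- Both sides are 0, the right one because `alternating (suc k)` starts with a zero.
entry≡moment k zero    zero    = refl
entry≡moment k zero    (suc j) = entry-ballot k 0 (suc j) j refl
entry≡moment k (suc i) j       = entry-ballot k (suc i) j (i + j) refl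

det-matrix : ∀ k n → det (matrix k n) ≡ Det n (T (suc k)) / 1
det-matrix k n = trans
  (det-/1 n {N = λ i j → X (suc k) (i + j) 0} (λ i j → entry≡moment k (toℕ i) (toℕ j)))
  (cong (_/ 1) (trans (Det-hankel n (suc k)) (Det-X n k)))

-- The three cases of the theorem

-1^≡sgn : ∀ n → -1ℤ ℤ.^ n ≡ sgn n
-1^≡sgn zero    = refl
-1^≡sgn (suc n) = trans (cong (-1ℤ ℤ.*_) (-1^≡sgn n)) (ℤ.-1*i≡-i (sgn n))

theorem19 : ∀ (n k : ℕ) → n ≥ 1 →
    (∀ (n₁ : ℕ) → n ≡ (k + 1) * n₁ →
    det (matrix k n) ≡ ((-1ℤ ℤ.^ (n₁ * ((k + 1) C 2) + 1)) ℤ.* (+ n₁ ℤ.- 1ℤ)) / 1)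
    × (∀ (n₁ : ℕ) → k ≢ 0 → n ≡ (k + 1) * n₁ + 1 →
    det (matrix k n) ≡ ((-1ℤ ℤ.^ (n₁ * ((k + 1) C 2) + k + 1)) ℤ.* (+ n₁)) / 1)
    × (n % suc k ≢ 0 % suc k → n % suc k ≢ 1 % suc k →
    det (matrix k n) ≡ 0ℚ)
theorem19 n k n≥1 = multiple , multiple+1 , otherwise
  where
  K = suc k

  multiple : ∀ n₁ → n ≡ (k + 1) * n₁ →
    det (matrix k n) ≡ ((-1ℤ ℤ.^ (n₁ * ((k + 1) C 2) + 1)) ℤ.* (+ n₁ ℤ.- 1ℤ)) / 1
  multiple zero    n≡ = contradiction (subst (1 ≤_) (trans n≡ (ℕ.*-zeroʳ (k + 1))) n≥1) λ ()
  -- The factor n₁ - 1 evaluates to m, the number of blocks after the K leading zeros of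
  -- `alternating K`.
  multiple (suc m) n≡ = trans (det-matrix k n) (cong (_/ 1) (begin
    Det n (T K)                                    ≡⟨ cong (λ l → Det l (T K)) (trans n≡ (trans (cong (_* suc m) (ℕ.+-comm k 1)) (ℕ.*-comm K (suc m)))) ⟩
    Det (suc m * K) (T K)                          ≡⟨ Det-T-multiple k m ⟩
    ℤ.- (+ m ℤ.* Det (suc m * K) (S K))            ≡⟨ cong (λ x → ℤ.- (+ m ℤ.* x)) (Det-S K (suc m)) ⟩
    ℤ.- (+ m ℤ.* sgn (suc m * (K C 2)))            ≡⟨ rearrange (+ m) (sgn (suc m * (K C 2))) ⟩
    ℤ.- sgn (suc m * (K C 2)) ℤ.* + m              ≡⟨ cong (λ x → sgn x ℤ.* + m) (ℕ.+-comm (suc m * (K C 2)) 1) ⟨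
    sgn (suc m * (K C 2) + 1) ℤ.* + m              ≡⟨ cong (λ l → sgn (suc m * (l C 2) + 1) ℤ.* + m) (ℕ.+-comm k 1) ⟨
    sgn (suc m * ((k + 1) C 2) + 1) ℤ.* + m        ≡⟨ cong (ℤ._* + m) (-1^≡sgn (suc m * ((k + 1) C 2) + 1)) ⟨
    (-1ℤ ℤ.^ (suc m * ((k + 1) C 2) + 1)) ℤ.* + m  ∎))
    where
    rearrange : ∀ x s → ℤ.- (x ℤ.* s) ≡ ℤ.- s ℤ.* x
    rearrange = solve-∀

  multiple+1 : ∀ n₁ → k ≢ 0 → n ≡ (k + 1) * n₁ + 1 →
    det (matrix k n) ≡ ((-1ℤ ℤ.^ (n₁ * ((k + 1) C 2) + k + 1)) ℤ.* (+ n₁)) / 1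
  multiple+1 m _ n≡ = trans (det-matrix k n) (cong (_/ 1) (begin
    Det n (T K)                                       ≡⟨ cong (λ l → Det l (T K)) (trans n≡ (size k m)) ⟩
    Det (suc (m * K)) (T K)                           ≡⟨ Det-T-multiple+1 k m ⟩
    + m ℤ.* (sgn K ℤ.* Det (m * K) (S K))             ≡⟨ cong (λ x → + m ℤ.* (sgn K ℤ.* x)) (Det-S K m) ⟩
    + m ℤ.* (sgn K ℤ.* sgn (m * (K C 2)))             ≡⟨ cong (+ m ℤ.*_) (sgn-+ K (m * (K C 2))) ⟨
    + m ℤ.* sgn (K + m * (K C 2))                     ≡⟨ ℤ.*-comm (+ m) _ ⟩
    sgn (K + m * (K C 2)) ℤ.* + m                     ≡⟨ cong (λ x → sgn x ℤ.* + m) (exponent k (m * (K C 2))) ⟩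
    sgn (m * (K C 2) + k + 1) ℤ.* + m                 ≡⟨ cong (λ l → sgn (m * (l C 2) + k + 1) ℤ.* + m) (ℕ.+-comm k 1) ⟨
    sgn (m * ((k + 1) C 2) + k + 1) ℤ.* + m           ≡⟨ cong (ℤ._* + m) (-1^≡sgn (m * ((k + 1) C 2) + k + 1)) ⟨
    (-1ℤ ℤ.^ (m * ((k + 1) C 2) + k + 1)) ℤ.* + m     ∎))
    where
    size : ∀ k m → (k + 1) * m + 1 ≡ suc (m * suc k)
    size = solveℕ-∀

    exponent : ∀ k x → suc k + x ≡ x + k + 1
    exponent = solveℕ-∀

  otherwise : n % suc k ≢ 0 % suc k → n % suc k ≢ 1 % suc k → det (matrix k n) ≡ 0ℚ
  otherwise s≢0 s≢1 = trans (det-matrix k n) (cong (_/ 1) (trans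
    (cong (λ l → Det l (T K)) (trans (m≡m%n+[m/n]*n n K) (ℕ.+-comm (n % K) _)))
    (Det-T-otherwise k (n /ℕ K) (n % K) (two≤ k (n % K) (ℕ.≤-pred (m%n<n n K)) s≢0 s≢1) (ℕ.≤-pred (m%n<n n K)))))
    where
    two≤ : ∀ k s → s ≤ k → s ≢ 0 → s ≢ 1 % suc k → 2 ≤ s
    two≤ k       zero          _   s≢0 _   = contradiction refl s≢0
    -- For k = 0 this residue is excluded by s ≤ k; for larger k, 1 % K evaluates to 1.
    two≤ (suc k) (suc zero)    _   _   s≢1 = contradiction refl s≢1
    two≤ k       (suc (suc s)) _   _   _   = s≤s (s≤s z≤n)
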